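{- Let $j\ge 1$ and let $\alpha,\beta\in\mathcal{S}_j$ be involutions. Let $T_\alpha$ be a set of patterns, each of which begins with the prefix $\alpha$, and let $T_\beta$ be the set of patterns obtained by replacing, in each pattern in $T_\alpha$, the prefix $\alpha$ with the prefix $\beta$. For a shape $\lambda$ and a set $T$ of patterns, let $\lambda_{sym}(T)$ be the number of symmetric full placements on $\lambda$ which avoid all of the patterns in $T$. If for every self-conjugate shape $\lambda$ we have $\lambda_{sym}(\{\alpha\})=\lambda_{sym}(\{\beta\})$, then for every self-conjugate shape $\mu$ $$\mu_{sym}(T_\alpha)=\mu_{sym}(T_\beta).$$
   Context: A shape is a Ferrers shape $\lambda=(\lambda_1\ge\lambda_2\ge\cdots\ge\lambda_k>0)$, coordinatized from the bottom left corner: box $(x,y)$ (column $x$ from the left, row $y$ from the bottom) belongs to $\lambda$ iff $1\le y\le k$ and $1\le x\le\lambda_y$. It is self-conjugate if $(x,y)\in\lambda$ iff $(y,x)\in\lambda$. A placement on $\lambda$ is an assignment of dots to some boxes of $\lambda$ such that no row or column contains more than one dot; it is full if each row and each column of $\lambda$ contains exactly one dot. A placement on a self-conjugate shape is symmetric if it has a dot in $(x,y)$ iff it has a dot in $(y,x)$. The pattern of a sequence of $m$ distinct numbers is its order-preserving relabelling by $1,\dots,m$. A pattern is a permutation $\sigma\in\mathcal{S}_m$ written in one-line notation. A placement on $\lambda$ contains $\sigma\in\mathcal{S}_m$ if there are $m$ dots $(x_1,y_1),\dots,(x_m,y_m)$ in the placement with $x_1<\cdots<x_m$, with the pattern of $y_1\ldots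 y_m$ equal to $\sigma$, and all lying in a rectangular subshape of $\lambda$ (i.e. the box $(\max_i x_i,\max_i y_i)$ lies in $\lambda$). Otherwise it avoids $\sigma$. For $\alpha\in\mathcal{S}_j$, a pattern begins with the prefix $\alpha$ if it is of the form $\alpha\tau=\alpha_1\ldots\alpha_j\tau_{j+1}\ldots\tau_k$ with $k\ge j$ and $\tau=\tau_{j+1}\ldots\tau_k$ an ordering of $\{j+1,\dots,k\}$; replacing the prefix $\alpha$ by $\beta\in\mathcal{S}_j$ turns $\alpha\tau$ into $\beta\tau$. -}

module Defs where

open import Data.Bool.Base using (true; false)
open import Data.Fin.Base using (Fin; toℕ)
open import Data.Fin.Permutation using (Permutation′; _⟨$⟩ʳ_)
open import Data.Fin.Subset using (Subset; _∈_)
open import Data.List.Base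
  using (List; []; _∷_; [_]; _++_; length; lookup; map; filter; tabulate; applyUpTo; cartesianProductWith)
open import Data.List.Extrema.Nat using (max)
open import Data.List.Membership.Propositional using () renaming (_∈_ to _∈ₗ_)
open import Data.List.Membership.Propositional.Properties
  using (∈-lookup; ∈-cartesianProductWith⁺; ∈-filter⁺; ∈-filter⁻)
open import Data.List.Membership.Propositional.Properties.WithK using (unique∧set⇒bag)
open import Data.List.Relation.Binary.BagAndSetEquality using (∼bag⇒↭)
open import Data.List.Relation.Binary.Permutation.Propositional using (_↭_)
open import Data.List.Relation.Binary.Permutation.Propositional.Properties using (↭-length)
open import Data.List.Relation.Unary.All as All using (All; []; _∷_)
open import Data.List.Relation.Unary.Any using (here; there)
open import Data.List.Relation.Unary.AllPairs using ([]; _∷_)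
open import Data.List.Relation.Unary.Linked using (Linked)
open import Data.List.Relation.Unary.Unique.Propositional using (Unique)
import Data.List.Relation.Unary.Unique.Propositional.Properties as Unique
open import Data.Nat.Base using (ℕ; zero; suc; _+_; _≤_; _<_; _≥_)
open import Data.Nat.Properties using (_≤?_)
open import Data.Product.Base using (∃; ∃₂; _×_; _,_; proj₁; proj₂)
open import Data.Product using (∃!)
open import Data.Vec.Base using ([]; _∷_)
open import Function.Base using (_on_)
open import Function.Bundles using (_⇔_; mk⇔)
open import Function.Construct.Composition using (_⇔-∘_)
open import Function.Construct.Symmetry using (⇔-sym)
open import Level using (Level)
open import Relation.Binary.PropositionalEquality.Core using (_≡_; refl)
open import Relation.Nullary.Negation.Core using (¬_)
open import Relation.Nullary.Decidable using (Dec; ¬¬-excluded-middle)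
open import Relation.Unary using (Pred)

private
  variable
    ℓ : Level

------------------------------------------------------------------------
-- Shapes

-- The empty shape is allowed.
record Shape : Set where
  field
    rows       : List ℕ
    decreasing : Linked _≥_ rows
    positive   : All (0 <_) rows

open Shape public

-- Column first, row second, both counted from 1.
Coord : Set
Coord = ℕ × ℕ

infix 4 _∈ₛ_

_∈ₛ_ : Coord → Shape → Set
(x , y) ∈ₛ μ = ∃ λ (i : Fin (length (rows μ))) →
  y ≡ suc (toℕ i) × 1 ≤ x × x ≤ lookup (rows μ) i

SelfConjugate : Shape → Set
SelfConjugate μ = ∀ x y → (x , y) ∈ₛ μ ⇔ (y , x) ∈ₛ μ

------------------------------------------------------------------------
-- Placements

-- An arbitrary set of boxes, given row by row: the row of length l
-- holds a subset of its l boxes.  Propositional equality of fillings is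
-- equality of the sets of dots.
Filling : Shape → Set
Filling μ = All Subset (rows μ)

module _ (μ : Shape) where

  Dot : Filling μ → Pred Coord _
  Dot p (x , y) =
    ∃ λ (i : Fin (length (rows μ))) → ∃ λ (c : Fin (lookup (rows μ) i)) →
      x ≡ suc (toℕ c) × y ≡ suc (toℕ i) × c ∈ All.lookup p (∈-lookup i)

  record IsPlacement (p : Filling μ) : Set where
    field
      row-unique : ∀ {x x′ y} → Dot p (x , y) → Dot p (x′ , y) → x ≡ x′
      col-unique : ∀ {x y y′} → Dot p (x , y) → Dot p (x , y′) → y ≡ y′

  -- The rows and columns of μ are those that contain a box of μ.
  record IsFull (p : Filling μ) : Set where
    field
      row-full : ∀ {x y} → (x , y) ∈ₛ μ → ∃! _≡_ λ x′ → Dot p (x′ , y)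
      col-full : ∀ {x y} → (x , y) ∈ₛ μ → ∃! _≡_ λ y′ → Dot p (x , y′)

  IsSymmetric : Filling μ → Set
  IsSymmetric p = ∀ x y → Dot p (x , y) ⇔ Dot p (y , x)

------------------------------------------------------------------------
-- Patterns

-- Words are lists of numbers; a permutation of Fin m is read as the
-- word of its values, shifted to 1 , … , m.
Word : Set
Word = List ℕ

oneLine : ∀ {m} → Permutation′ m → Word
oneLine σ = tabulate (λ i → suc (toℕ (σ ⟨$⟩ʳ i)))

-- Each entry is relabelled by its rank.  For a word with distinct
-- entries this is the order-preserving relabelling by 1 , … , m.
pattern-of : Word → Word
pattern-of w = map (λ y → length (filter (_≤? y) w)) w

module _ (μ : Shape) where

  -- The maxima are taken over ds with default 0, so the empty word is
  -- never contained; no pattern with a prefix of length ≥ 1 is empty.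
  Contains : Filling μ → Word → Set
  Contains p σ = ∃ λ (ds : List Coord) →
    All (Dot μ p) ds ×
    Linked (_<_ on proj₁) ds ×
    pattern-of (map proj₂ ds) ≡ σ ×
    (max 0 (map proj₁ ds) , max 0 (map proj₂ ds)) ∈ₛ μ

  Avoids : Filling μ → Pred Word ℓ → Set ℓ
  Avoids p T = ∀ σ → T σ → ¬ Contains p σ

BeginsWith : ∀ {j} → Permutation′ j → Pred Word _
BeginsWith {j} α σ = ∃₂ λ (r : ℕ) (τ : Word) →
  τ ↭ applyUpTo (λ i → suc (j + i)) r × σ ≡ oneLine α ++ τ

replacePrefix : ∀ {j} → (α β : Permutation′ j) → Pred Word ℓ → Pred Word ℓ
replacePrefix α β T σ = ∃ λ τ → T (oneLine α ++ τ) × σ ≡ oneLine β ++ τ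

------------------------------------------------------------------------
-- Counting

-- Exactly n elements satisfy P.
HasCount : ∀ {a} {A : Set a} → Pred A ℓ → ℕ → Set _
HasCount {A = A} P n = ∃ λ (xs : List A) →
  Unique xs × (∀ x → x ∈ₗ xs ⇔ P x) × length xs ≡ n

HasCount-unique : ∀ {a} {A : Set a} {P : Pred A ℓ} {m n} →
                  HasCount P m → HasCount P n → m ≡ n
HasCount-unique (xs , xs! , xs⇔P , refl) (ys , ys! , ys⇔P , refl) =
  ↭-length (∼bag⇒↭ (unique∧set⇒bag xs! ys! (⇔-sym (ys⇔P _) ⇔-∘ xs⇔P _)))

SymFullAvoiding : (μ : Shape) → Pred Word ℓ → Pred (Filling μ) ℓ
SymFullAvoiding μ T p =
  IsPlacement μ p × IsFull μ p × IsSymmetric μ p × Avoids μ p T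

-- The graph of T ↦ μ_sym(T).  It is a relation because T is arbitrary:
-- computing the number would require deciding membership in T.
-- Classically it is total, see SymCount-exists.
SymCount : Shape → Pred Word ℓ → ℕ → Set ℓ
SymCount μ T = HasCount (SymFullAvoiding μ T)

subsets : ∀ n → List (Subset n)
subsets zero    = [ [] ]
subsets (suc n) = cartesianProductWith _∷_ (false ∷ true ∷ []) (subsets n)

∈-subsets : ∀ {n} (s : Subset n) → s ∈ₗ subsets n
∈-subsets []          = here refl
∈-subsets (false ∷ s) =
  ∈-cartesianProductWith⁺ _∷_ {xs = false ∷ true ∷ []} (here refl) (∈-subsets s)
∈-subsets (true  ∷ s) =
  ∈-cartesianProductWith⁺ _∷_ {xs = false ∷ true ∷ []} (there (here refl)) (∈-subsets s)

subsets! : ∀ n → Unique (subsets n)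
subsets! zero    = [] ∷ []
subsets! (suc n) =
  Unique.cartesianProductWith⁺ _∷_ (λ { refl → refl , refl })
    (((λ ()) ∷ []) ∷ [] ∷ []) (subsets! n)

fillings : ∀ ls → List (All Subset ls)
fillings []       = [ [] ]
fillings (l ∷ ls) = cartesianProductWith _∷_ (subsets l) (fillings ls)

∈-fillings : ∀ {ls} (p : All Subset ls) → p ∈ₗ fillings ls
∈-fillings []      = here refl
∈-fillings (s ∷ p) = ∈-cartesianProductWith⁺ _∷_ (∈-subsets s) (∈-fillings p)

fillings! : ∀ ls → Unique (fillings ls)
fillings! []       = [] ∷ []
fillings! (l ∷ ls) =
  Unique.cartesianProductWith⁺ _∷_ (λ { refl → refl , refl })
    (subsets! l) (fillings! ls)

¬¬-decidable-on : ∀ {a} {A : Set a} (P : Pred A ℓ) (xs : List A) →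
                  ¬ ¬ All (λ x → Dec (P x)) xs
¬¬-decidable-on P []       k = k []
¬¬-decidable-on P (x ∷ xs) k =
  ¬¬-excluded-middle λ d → ¬¬-decidable-on P xs λ ds → k (d ∷ ds)

SymCount-exists : ∀ μ (T : Pred Word ℓ) → ¬ ¬ ∃ (SymCount μ T)
SymCount-exists μ T k = ¬¬-decidable-on (SymFullAvoiding μ T) (fillings (rows μ)) λ ds →
  let P? = λ p → All.lookup ds (∈-fillings p) in
  k (_ , filter P? (fillings (rows μ)) ,
     Unique.filter⁺ P? (fillings! (rows μ)) ,
     (λ p → mk⇔ (λ p∈ → proj₂ (∈-filter⁻ P? {xs = fillings (rows μ)} p∈))
                (∈-filter⁺ P? (∈-fillings p))) ,
     refl)

{-# OPTIONS --safe #-}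

-- Shade a box of μ if, for some ατ ∈ Tα, there is an occurrence of τ strictly above and to the
-- right of that box or of its mirror image.  A symmetric full placement avoids all γτ exactly when
-- its restriction to the shaded region avoids γ: an occurrence of γ may have to be reflected in the
-- diagonal before a τ can be appended, which is harmless because γ is an involution.  The shaded
-- region is determined by the unshaded dots.  Hence, among the placements with prescribed unshaded
-- dots, those that avoid all γτ correspond to the γ-avoiding symmetric full placements on the
-- self-conjugate shape left after deleting the rows and columns of the unshaded dots, and the
-- hypothesis applies to this shape.
module Submission where

open import Defs
open import Algebra.Definitions using (Involutive)
open import Data.Bool.Base using (Bool; true; false)
open import Data.Bool.Properties using (⇔→≡)
open import Data.Fin.Base as Fin using (Fin; zero; suc; toℕ)
open import Data.Fin.Permutation using (Permutation′; _⟨$⟩ʳ_)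
open import Data.Fin.Properties using (toℕ<n; toℕ-injective)
open import Data.Fin.Subset using (Subset; _∈_)
open import Data.List.Base
  using (List; []; _∷_; _++_; length; lookup; map; filter; tabulate; applyUpTo; upTo; cartesianProduct)
open import Data.List.Extrema.Nat using (max; max≤v⁺; max<v⁺; xs≤max; argmax-all)
open import Data.List.Membership.Propositional using () renaming (_∈_ to _∈ₗ_)
open import Data.List.Membership.Propositional.Properties
  using (∈-lookup; ∈-tabulate⁺; ∈-tabulate⁻; ∈-map⁺; ∈-map⁻; ∈-filter⁺; ∈-filter⁻; ∈-cartesianProduct⁺; ∈-upTo⁺)
open import Data.List.Membership.Propositional.Properties.WithK using (unique∧set⇒bag)
open import Data.List.Properties
open import Data.List.Relation.Binary.BagAndSetEquality using (∼bag⇒↭)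
open import Data.List.Relation.Binary.Permutation.Propositional using (_↭_; ↭-sym)
open import Data.List.Relation.Binary.Permutation.Propositional.Properties
  using (↭-length; filter-↭; All-resp-↭)
open import Data.List.Relation.Unary.All as All using (All; []; _∷_)
import Data.List.Relation.Unary.All.Properties as All
open import Data.List.Relation.Unary.AllPairs as AllPairs using (AllPairs; []; _∷_)
import Data.List.Relation.Unary.AllPairs.Properties as AllPairs
open import Data.List.Relation.Unary.Any using (here; there)
open import Data.List.Relation.Unary.Linked using (Linked; []; [-]; _∷_)
import Data.List.Relation.Unary.Linked.Properties as Linked
open import Data.List.Relation.Unary.Unique.Propositional using (Unique)
import Data.List.Relation.Unary.Unique.Propositional.Properties as Unique
open import Data.Nat.Base
  using (ℕ; zero; suc; _+_; _≤_; _<_; _≥_; z≤n; s≤s; z<s; s<s; s≤s⁻¹)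
open import Data.Nat.Properties
open import Data.Product.Base using (∃; ∃₂; _×_; _,_; proj₁; proj₂; swap; uncurry)
open import Data.Sum.Base as Sum using (_⊎_; inj₁; inj₂)
open import Data.Vec.Base using ([]; _∷_; here; there)
open import Function.Base using (_∘_; _on_; id)
open import Function.Bundles using (_⇔_; mk⇔; Equivalence)
open import Function.Construct.Composition using (_⇔-∘_)
open import Function.Construct.Symmetry using (⇔-sym)
open import Level using (Level)
open import Relation.Binary.Core using (Rel)
import Relation.Binary.Definitions as Binary using (Decidable)
open import Relation.Binary.PropositionalEquality
open import Relation.Nullary.Decidable
  using (Dec; yes; no; does; map′; _×-dec_; _⊎-dec_; ¬?; dec-true; decidable-stable)
open import Relation.Nullary.Negation using (¬_; contradiction)
open import Relation.Unary using (Pred; Decidable; _⊆_; ｛_｝)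
open import Relation.Unary.Properties using (∁?)
open Equivalence using (to; from)

private
  variable
    a ℓ ℓ′ : Level
    A B : Set a

-- Shapes and fillings as sets of boxes

-- Rows count from 0 here, and rows beyond the last get length 0, so a positive length already
-- certifies a valid index.
rowLength : List ℕ → ℕ → ℕ
rowLength []       _       = 0
rowLength (l ∷ ls) zero    = l
rowLength (l ∷ ls) (suc y) = rowLength ls y

rowLength-toℕ : ∀ ls (i : Fin (length ls)) → rowLength ls (toℕ i) ≡ lookup ls i
rowLength-toℕ (l ∷ ls) zero    = refl
rowLength-toℕ (l ∷ ls) (suc i) = rowLength-toℕ ls i

rowLength-index : ∀ ls y → 0 < rowLength ls y → ∃ λ (i : Fin (length ls)) → y ≡ toℕ i
rowLength-index (l ∷ ls) zero    _  = zero , refl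
rowLength-index (l ∷ ls) (suc y) 0<
  with i , refl ← rowLength-index ls y 0< = suc i , refl

rowLength-anti : ∀ {ls} → Linked _≥_ ls → ∀ {y y′} → y ≤ y′ → rowLength ls y′ ≤ rowLength ls y
rowLength-anti []          _                            = z≤n
rowLength-anti [-]         {zero} {zero}  _             = ≤-refl
rowLength-anti [-]         {zero} {suc _} _             = z≤n
rowLength-anti [-]         (s≤s _)                      = z≤n
rowLength-anti (_ ∷ _)     {zero} {zero}  _             = ≤-refl
rowLength-anti (l≥l′ ∷ ls) {zero} {suc y′} _            =
  ≤-trans (rowLength-anti ls {0} {y′} z≤n) l≥l′
rowLength-anti (_ ∷ ls)    (s≤s y≤y′)                   = rowLength-anti ls y≤y′

rowLength-applyUpTo : ∀ f {n y} → y < n → rowLength (applyUpTo f n) y ≡ f y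
rowLength-applyUpTo f {suc n} {zero}  _         = refl
rowLength-applyUpTo f {suc n} {suc y} (s≤s y<n) = rowLength-applyUpTo (f ∘ suc) y<n

rowLength-applyUpTo⁻ : ∀ f {n y} → 0 < rowLength (applyUpTo f n) y → y < n
rowLength-applyUpTo⁻ f {suc n} {zero}  _  = z<s
rowLength-applyUpTo⁻ f {suc n} {suc y} 0< = s<s (rowLength-applyUpTo⁻ (f ∘ suc) 0<)

∈ₛ⇒< : ∀ μ {x y} → (suc x , suc y) ∈ₛ μ → x < rowLength (rows μ) y
∈ₛ⇒< μ (i , refl , _ , x≤) = subst (_ ≤_) (sym (rowLength-toℕ (rows μ) i)) x≤

<⇒∈ₛ : ∀ μ {x y} → x < rowLength (rows μ) y → (suc x , suc y) ∈ₛ μ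
<⇒∈ₛ μ {y = y} x< with i , refl ← rowLength-index (rows μ) y (≤-<-trans z≤n x<) =
  i , refl , z<s , subst (_ ≤_) (rowLength-toℕ (rows μ) i) x<

∈ₛ-positive : ∀ μ {x y} → (x , y) ∈ₛ μ → 1 ≤ x × 1 ≤ y
∈ₛ-positive μ (i , refl , 1≤x , _) = 1≤x , z<s

∈ₛ-down : ∀ μ {x y x′ y′} → 1 ≤ x′ → 1 ≤ y′ → x′ ≤ x → y′ ≤ y →
          (x , y) ∈ₛ μ → (x′ , y′) ∈ₛ μ
∈ₛ-down μ (s≤s _) (s≤s _) (s≤s x′≤x) (s≤s y′≤y) ∈μ =
  <⇒∈ₛ μ (<-≤-trans (≤-<-trans x′≤x (∈ₛ⇒< μ ∈μ)) (rowLength-anti (decreasing μ) y′≤y))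

∈ₛ⇒≤height : ∀ μ {x y} → (x , y) ∈ₛ μ → y ≤ length (rows μ)
∈ₛ⇒≤height μ (i , refl , _) = toℕ<n i

_∈ₛ?_ : ∀ c μ → Dec (c ∈ₛ μ)
(zero  , y)     ∈ₛ? μ = no λ ()
(suc x , zero)  ∈ₛ? μ = no λ ()
(suc x , suc y) ∈ₛ? μ = map′ (<⇒∈ₛ μ) (∈ₛ⇒< μ) (x <? rowLength (rows μ) y)

-- Reading `false` out of range turns dependent subsets into plain functions; with `mark`, fillings
-- can be compared without `Fin` indices.
bit : ∀ {n} → Subset n → ℕ → Bool
bit []      _       = false
bit (b ∷ s) zero    = b
bit (b ∷ s) (suc x) = bit s x

∈⇒bit : ∀ {n} {s : Subset n} {c} → c ∈ s → bit s (toℕ c) ≡ true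
∈⇒bit here       = refl
∈⇒bit (there c∈) = ∈⇒bit c∈

bit⇒∈ : ∀ {n} (s : Subset n) x → bit s x ≡ true → ∃ λ c → x ≡ toℕ c × c ∈ s
bit⇒∈ (true ∷ s) zero    _  = zero , refl , here
bit⇒∈ (_ ∷ s)    (suc x) b≡ with c , refl , c∈ ← bit⇒∈ s x b≡ = suc c , refl , there c∈

bit-injective : ∀ {n} (s t : Subset n) → (∀ x → bit s x ≡ bit t x) → s ≡ t
bit-injective []      []      _  = refl
bit-injective (b ∷ s) (c ∷ t) eq = cong₂ _∷_ (eq 0) (bit-injective s t (eq ∘ suc))

mark : ∀ {ls} → All Subset ls → ℕ → ℕ → Bool
mark []      _       _ = false
mark (s ∷ p) zero    x = bit s x
mark (s ∷ p) (suc y) x = mark p y x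

mark-lookup : ∀ {ls} (p : All Subset ls) i x →
              mark p (toℕ i) x ≡ bit (All.lookup p (∈-lookup i)) x
mark-lookup (s ∷ p) zero    x = refl
mark-lookup (s ∷ p) (suc i) x = mark-lookup p i x

mark-index : ∀ {ls} (p : All Subset ls) y x → mark p y x ≡ true →
             ∃ λ (i : Fin (length ls)) → y ≡ toℕ i
mark-index (s ∷ p) zero    x _  = zero , refl
mark-index (s ∷ p) (suc y) x m≡ with i , refl ← mark-index p y x m≡ = suc i , refl

mark-injective : ∀ {ls} (p q : All Subset ls) → (∀ y x → mark p y x ≡ mark q y x) → p ≡ q
mark-injective []      []      _  = refl
mark-injective (s ∷ p) (t ∷ q) eq =
  cong₂ _∷_ (bit-injective s t (eq 0)) (mark-injective p q (eq ∘ suc))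

fillRow : (ℕ → Bool) → ∀ n → Subset n
fillRow f zero    = []
fillRow f (suc n) = f 0 ∷ fillRow (f ∘ suc) n

bit-fillRow : ∀ f {n x} → x < n → bit (fillRow f n) x ≡ f x
bit-fillRow f {suc n} {zero}  _         = refl
bit-fillRow f {suc n} {suc x} (s≤s x<n) = bit-fillRow (f ∘ suc) x<n

fillRows : (ℕ → ℕ → Bool) → ∀ ls → All Subset ls
fillRows f []       = []
fillRows f (l ∷ ls) = fillRow (f 0) l ∷ fillRows (f ∘ suc) ls

mark-fillRows : ∀ f ls y {x} → x < rowLength ls y → mark (fillRows f ls) y x ≡ f y x
mark-fillRows f (l ∷ ls) zero    x< = bit-fillRow (f 0) x<
mark-fillRows f (l ∷ ls) (suc y) x< = mark-fillRows (f ∘ suc) ls y x<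

module _ (μ : Shape) where

  Dot⇒mark : ∀ (p : Filling μ) {x y} → Dot μ p (suc x , suc y) → mark p y x ≡ true
  Dot⇒mark p (i , c , refl , refl , c∈) = trans (mark-lookup p i (toℕ c)) (∈⇒bit c∈)

  mark⇒Dot : ∀ (p : Filling μ) {x y} → mark p y x ≡ true → Dot μ p (suc x , suc y)
  mark⇒Dot p {x} {y} m≡ with i , refl ← mark-index p y x m≡
    with c , refl , c∈ ← bit⇒∈ (All.lookup p (∈-lookup i)) x
                           (trans (sym (mark-lookup p i x)) m≡)
    = i , c , refl , refl , c∈

  Dot⇒∈ₛ : ∀ (p : Filling μ) {c} → Dot μ p c → c ∈ₛ μ
  Dot⇒∈ₛ p (i , c , refl , refl , _) = i , refl , z<s , toℕ<n c

  Dot? : ∀ (p : Filling μ) → Decidable (Dot μ p)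
  Dot? p (zero  , y)     = no λ ()
  Dot? p (suc x , zero)  = no λ ()
  Dot? p (suc x , suc y) with mark p y x in eq
  ... | true  = yes (mark⇒Dot p eq)
  ... | false = no λ d → contradiction (trans (sym eq) (Dot⇒mark p d)) λ ()

  Filling-ext : ∀ (p q : Filling μ) → (∀ c → Dot μ p c ⇔ Dot μ q c) → p ≡ q
  Filling-ext p q p⇔q = mark-injective p q λ y x → ⇔→≡ {z = true}
    (mk⇔ (Dot⇒mark q ∘ to   (p⇔q _) ∘ mark⇒Dot p)
         (Dot⇒mark p ∘ from (p⇔q _) ∘ mark⇒Dot q))

  module _ {P : Pred Coord ℓ} (P? : Decidable P) where

    fill : Filling μ
    fill = fillRows (λ y x → does (P? (suc x , suc y))) (rows μ)

    mark-fill : ∀ {x y} → (suc x , suc y) ∈ₛ μ → mark fill y x ≡ does (P? (suc x , suc y))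
    mark-fill {y = y} ∈μ = mark-fillRows _ (rows μ) y (∈ₛ⇒< μ ∈μ)

    Dot-fill⁺ : ∀ {c} → c ∈ₛ μ → P c → Dot μ fill c
    Dot-fill⁺ {zero  , _}     (_ , _ , () , _) _
    Dot-fill⁺ {suc x , zero}  (_ , () , _)     _
    Dot-fill⁺ {suc x , suc y} ∈μ               Pc = mark⇒Dot fill
      (trans (mark-fill ∈μ) (dec-true (P? _) Pc))

    Dot-fill⁻ : ∀ {c} → Dot μ fill c → P c
    Dot-fill⁻ {zero  , _}     (_ , _ , () , _)
    Dot-fill⁻ {suc x , zero}  (_ , _ , _ , () , _)
    Dot-fill⁻ {suc x , suc y} d
      with P? (suc x , suc y) | trans (sym (mark-fill (Dot⇒∈ₛ fill d))) (Dot⇒mark fill d)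
    ... | yes Pc | _ = Pc

-- The search descends from the bound: the first hit carries everything below it, and each miss
-- lowers the bound by one.
threshold : ∀ {P : Pred ℕ ℓ} → Decidable P → (∀ {x y} → x ≤ y → P y → P x) →
            ∀ n → (∀ {x} → P x → x < n) → ∃ λ l → ∀ x → P x ⇔ x < l
threshold P? down zero    bound = 0 , λ x → mk⇔ bound λ ()
threshold P? down (suc n) bound with P? n
... | yes Pn = suc n , λ x → mk⇔ bound λ x<1+n → down (s≤s⁻¹ x<1+n) Pn
... | no ¬Pn = threshold P? down n
  λ {x} Px → ≤∧≢⇒< (s≤s⁻¹ (bound Px)) λ { refl → ¬Pn Px }

module ShapeOf
  {D : Pred Coord ℓ} (D? : Decidable D)
  (D-positive : ∀ {x y} → D (x , y) → 1 ≤ x × 1 ≤ y)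
  (D-down : ∀ {x y x′ y′} → 1 ≤ x′ → 1 ≤ y′ → x′ ≤ x → y′ ≤ y → D (x , y) → D (x′ , y′))
  (n : ℕ) (D-bounded : ∀ {x y} → D (x , y) → x ≤ n × y ≤ n)
  where

  private
    width : ∀ y → ∃ λ l → ∀ x → D (suc x , suc y) ⇔ x < l
    width y = threshold (λ x → D? (suc x , suc y))
      (λ x≤ → D-down z<s z<s (s≤s x≤) ≤-refl) n (proj₁ ∘ D-bounded)

    height : ∃ λ h → ∀ y → D (1 , suc y) ⇔ y < h
    height = threshold (λ y → D? (1 , suc y))
      (λ y≤ → D-down z<s z<s ≤-refl (s≤s y≤)) n (proj₂ ∘ D-bounded)

    len : ℕ → ℕ
    len y = proj₁ (width y)

    len-anti : ∀ y → len y ≥ len (suc y)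
    len-anti y = ≮⇒≥ λ l< → <-irrefl refl
      (to (proj₂ (width y) _)
        (D-down z<s z<s ≤-refl (n≤1+n _) (from (proj₂ (width (suc y)) _) l<)))

  -- The number of rows is read off the first column, so every listed row is nonempty.
  shape : Shape
  shape = record
    { rows       = applyUpTo len (proj₁ height)
    ; decreasing = Linked.applyUpTo⁺₂ len _ len-anti
    ; positive   = All.applyUpTo⁺₁ len _ λ y<h →
        to (proj₂ (width _) 0) (from (proj₂ height _) y<h)
    }

  ∈-shape⁺ : ∀ {c} → D c → c ∈ₛ shape
  ∈-shape⁺ {x , y} Dc with D-positive Dc
  ... | s≤s _ , s≤s _ = <⇒∈ₛ shape (subst (_ <_)
    (sym (rowLength-applyUpTo len (to (proj₂ height _) (D-down z<s z<s (s≤s z≤n) ≤-refl Dc))))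
    (to (proj₂ (width _) _) Dc))

  ∈-shape⁻ : ∀ {c} → c ∈ₛ shape → D c
  ∈-shape⁻ {zero  , _}     (_ , _ , () , _)
  ∈-shape⁻ {suc x , zero}  (_ , () , _)
  ∈-shape⁻ {suc x , suc y} ∈λ = from (proj₂ (width y) x) (subst (x <_)
    (rowLength-applyUpTo len (rowLength-applyUpTo⁻ len {proj₁ height} (≤-<-trans z≤n x<))) x<)
    where x< = ∈ₛ⇒< shape ∈λ

-- Patterns

++-allPairs⁻ : ∀ {R : Rel A ℓ} xs {ys} → AllPairs R (xs ++ ys) →
               AllPairs R xs × AllPairs R ys × All (λ x → All (R x) ys) xs
++-allPairs⁻ []       Rys = [] , Rys , []
++-allPairs⁻ (x ∷ xs) (Rx ∷ Rxsys) with Rxs , Rys , Rxs-ys ← ++-allPairs⁻ xs Rxsys =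
  All.++⁻ˡ xs Rx ∷ Rxs , Rys , All.++⁻ʳ xs Rx ∷ Rxs-ys

allPairs-tabulate⁻ : ∀ {R : Rel A ℓ} {n} {f : Fin n → A} → AllPairs R (tabulate f) →
                     ∀ {i k} → i Fin.< k → R (f i) (f k)
allPairs-tabulate⁻ (Rf ∷ _)  {zero}  {suc k} _         = All.tabulate⁻ Rf k
allPairs-tabulate⁻ (_ ∷ Rfs) {suc i} {suc k} (s≤s i<k) = allPairs-tabulate⁻ Rfs i<k

map≡++ : ∀ (f : A → B) zs us {vs} → map f zs ≡ us ++ vs →
         ∃₂ λ xs ys → zs ≡ xs ++ ys × map f xs ≡ us × map f ys ≡ vs
map≡++ f zs       []       eq = [] , zs , refl , refl , eq
map≡++ f (z ∷ zs) (u ∷ us) eq with fz≡u , eq′ ← ∷-injective eq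
  with xs , ys , refl , fxs≡us , fys≡vs ← map≡++ f zs us eq′ =
  z ∷ xs , ys , refl , cong₂ _∷_ fz≡u fxs≡us , fys≡vs

map≡tabulate : ∀ (f : A → B) zs {n} {g : Fin n → B} → map f zs ≡ tabulate g →
               ∃ λ (h : Fin n → A) → zs ≡ tabulate h × (∀ i → f (h i) ≡ g i)
map≡tabulate f []       {zero}  _  = (λ ()) , refl , λ ()
map≡tabulate f (z ∷ zs) {suc n} eq with fz≡ , eq′ ← ∷-injective eq
  with h , refl , fh≡ ← map≡tabulate f zs eq′ =
  (λ { zero → z ; (suc i) → h i }) , refl , λ { zero → fz≡ ; (suc i) → fh≡ i }

-- The relabelling inside `pattern-of`, separated from its word: `pattern-of w` is `map (rank w) w`
-- by definition.
rank : Word → ℕ → ℕ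
rank w y = length (filter (_≤? y) w)

rank-accept : ∀ {z y} w → z ≤ y → rank (z ∷ w) y ≡ suc (rank w y)
rank-accept {y = y} w z≤y = cong length (filter-accept (_≤? y) {xs = w} z≤y)

rank-reject : ∀ {z y} w → ¬ z ≤ y → rank (z ∷ w) y ≡ rank w y
rank-reject {y = y} w z≰y = cong length (filter-reject (_≤? y) {xs = w} z≰y)

rank-++ : ∀ u v y → rank (u ++ v) y ≡ rank u y + rank v y
rank-++ u v y = trans (cong length (filter-++ (_≤? y) u v)) (length-++ (filter (_≤? y) u))

rank-mono : ∀ w {y y′} → y ≤ y′ → rank w y ≤ rank w y′
rank-mono []      _    = z≤n
rank-mono (z ∷ w) {y} {y′} y≤y′ with z ≤? y
... | yes z≤y = subst₂ _≤_ (sym (rank-accept w z≤y)) (sym (rank-accept w (≤-trans z≤y y≤y′)))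
                  (s≤s (rank-mono w y≤y′))
... | no  z≰y = subst (_≤ rank (z ∷ w) y′) (sym (rank-reject w z≰y))
                  (≤-trans (rank-mono w y≤y′) (subst (rank w y′ ≤_) (sym (rank-++ (z ∷ []) w y′))
                    (m≤n+m _ _)))

-- Contrapositive of monotonicity; it pulls inequalities between letters of a pattern back to the
-- word.
rank-cancel-< : ∀ w {y y′} → rank w y < rank w y′ → y < y′
rank-cancel-< w r< = ≰⇒> λ y′≤y → <⇒≱ r< (rank-mono w y′≤y)

rank-below : ∀ {v y} → All (y <_) v → rank v y ≡ 0
rank-below y<v = cong length (filter-none (_≤? _) (All.map <⇒≱ y<v))

rank-above : ∀ {u y} → All (_≤ y) u → rank u y ≡ length u
rank-above u≤y = cong length (filter-all (_≤? _) u≤y)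

rank-sorted : ∀ {n} {x : Fin n → ℕ} → AllPairs _<_ (tabulate x) →
              ∀ k → rank (tabulate x) (x k) ≡ suc (toℕ k)
rank-sorted {x = x} (x₀< ∷ _) zero = trans
  (rank-accept (tabulate (x ∘ suc)) ≤-refl)
  (cong suc (rank-below x₀<))
rank-sorted {x = x} (x₀< ∷ x<) (suc k) = trans
  (rank-accept (tabulate (x ∘ suc)) (<⇒≤ (All.tabulate⁻ x₀< k)))
  (cong suc (rank-sorted x< k))

rank-↭ : ∀ {u v} → u ↭ v → ∀ y → rank u y ≡ rank v y
rank-↭ u↭v y = ↭-length (filter-↭ (_≤? y) u↭v)

rank-map : ∀ {e : ℕ → ℕ} → (∀ {x y} → x ≤ y → e x ≤ e y) → (∀ {x y} → e x ≤ e y → x ≤ y) →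
           ∀ w y → rank (map e w) (e y) ≡ rank w y
rank-map e-mono e-cancel []      y = refl
rank-map e-mono e-cancel (z ∷ w) y with z ≤? y
... | yes z≤y = trans (rank-accept (map _ w) (e-mono z≤y))
                  (trans (cong suc (rank-map e-mono e-cancel w y)) (sym (rank-accept w z≤y)))
... | no  z≰y = trans (rank-reject (map _ w) (z≰y ∘ e-cancel))
                  (trans (rank-map e-mono e-cancel w y) (sym (rank-reject w z≰y)))

pattern-of-map : ∀ {e : ℕ → ℕ} → (∀ {x y} → x ≤ y → e x ≤ e y) →
                 (∀ {x y} → e x ≤ e y → x ≤ y) →
                 ∀ w → pattern-of (map e w) ≡ pattern-of w
pattern-of-map e-mono e-cancel w =
  trans (sym (map-∘ w)) (map-cong (rank-map e-mono e-cancel w) w)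

_≪_ : Word → Word → Set
u ≪ v = All (λ y → All (y <_) v) u

map-rank-lower : ∀ {u v} → u ≪ v → map (rank (u ++ v)) u ≡ pattern-of u
map-rank-lower {u} {v} u≪v = map-cong-local (All.map
  (λ {y} y<v → trans (rank-++ u v y) (trans (cong (rank u y +_) (rank-below y<v)) (+-identityʳ _)))
  u≪v)

-- All of `u` is counted in the rank of each entry of `v`.
map-rank-upper : ∀ {u v} → u ≪ v → map (rank (u ++ v)) v ≡ map (length u +_) (pattern-of v)
map-rank-upper {u} {v} u≪v = trans
  (map-cong-local (All.map
    (λ {y} u<y → trans (rank-++ u v y) (cong (_+ rank v y) (rank-above (All.map <⇒≤ u<y))))
    (All.All-swap u≪v)))
  (map-∘ v)

Above : Coord → Pred Coord _
Above (x , y) (x′ , y′) = x < x′ × y < y′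

Within : Coord → Pred Coord _
Within (x , y) (x′ , y′) = x′ ≤ x × y′ ≤ y

-- `Contains` without its rectangle condition, over any set of dots. `AllPairs` instead of `Linked`
-- makes splitting and concatenating easy.
record Copy (S : Pred Coord ℓ) (σ : Word) (ds : List Coord) : Set ℓ where
  constructor copy
  field
    dots      : All S ds
    ascending : AllPairs (_<_ on proj₁) ds
    pattern≡  : pattern-of (map proj₂ ds) ≡ σ

-- The letters of a tail exceed `j`, while the pattern of its dots is numbered from 1; the shift by
-- `j` reconciles them.
Tail : ℕ → Pred Coord ℓ → Word → Pred (List Coord) ℓ
Tail j S τ ds = All S ds × AllPairs (_<_ on proj₁) ds × map (j +_) (pattern-of (map proj₂ ds)) ≡ τ

above⇒≪ : ∀ {ds₁ ds₂} → All (λ c → All (Above c) ds₂) ds₁ → map proj₂ ds₁ ≪ map proj₂ ds₂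
above⇒≪ above = All.map⁺ (All.map (All.map⁺ ∘ All.map proj₂) above)

module _ {j} (γ : Permutation′ j) where

  oneLine≤ : All (_≤ j) (oneLine γ)
  oneLine≤ = All.tabulate⁺ λ i → toℕ<n (γ ⟨$⟩ʳ i)

  -- Reflecting the dots in the diagonal inverts the pattern, and γ is its own inverse.
  copy-reflect : Involutive _≡_ (γ ⟨$⟩ʳ_) → ∀ {S : Pred Coord ℓ} → (∀ {c} → S c → S (swap c)) →
                 ∀ {ds} → Copy S (oneLine γ) ds →
                 ∃ λ ds′ → Copy S (oneLine γ) ds′ ×
                   (∀ {c} → All (Within c) ds → All (Within (swap c)) ds′)
  copy-reflect γγ S-sym {ds} (copy S-ds asc pat)
    with h , refl , rank-h ← map≡tabulate (rank (map proj₂ ds) ∘ proj₂) ds (trans (map-∘ ds) pat)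
    = tabulate h′
    , copy (All.tabulate⁺ λ i → S-sym (All.tabulate⁻ S-ds (γ ⟨$⟩ʳ i)))
           (AllPairs.tabulate⁺-< λ {i} {k} i<k → rank-cancel-< (map proj₂ ds)
             (subst₂ _<_ (sym (rank-γ i)) (sym (rank-γ k)) (s<s i<k)))
           (begin
             pattern-of (map proj₂ (tabulate h′))
               ≡⟨ cong pattern-of (map-tabulate h′ proj₂) ⟩
             pattern-of (tabulate (x ∘ (γ ⟨$⟩ʳ_)))
               ≡⟨ map-tabulate (x ∘ (γ ⟨$⟩ʳ_)) (rank (tabulate (x ∘ (γ ⟨$⟩ʳ_)))) ⟩
             tabulate (λ i → rank (tabulate (x ∘ (γ ⟨$⟩ʳ_))) (x (γ ⟨$⟩ʳ i)))
               -- The mirrored heights are the original columns in another order. Ranks ignore the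
               -- order, and in the increasing list `x` the entry at γ(i) has rank γ(i)+1.
               ≡⟨ tabulate-cong (λ i → trans (rank-↭ x∘γ↭x _) (rank-sorted x-asc (γ ⟨$⟩ʳ i))) ⟩
             oneLine γ ∎)
    , λ w → All.tabulate⁺ λ i → swap (All.tabulate⁻ w (γ ⟨$⟩ʳ i))
    where
    open ≡-Reasoning
    -- The dot `h k` has height rank γ(k)+1, so by involutivity `h (γ i)` has height rank i+1: this
    -- order sorts the mirror images by column.
    h′ = λ i → swap (h (γ ⟨$⟩ʳ i))
    x  = proj₁ ∘ h

    rank-γ : ∀ i → rank (map proj₂ ds) (proj₂ (h (γ ⟨$⟩ʳ i))) ≡ suc (toℕ i)
    rank-γ i = trans (rank-h _) (cong (suc ∘ toℕ) (γγ i))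

    x-asc : AllPairs _<_ (tabulate x)
    x-asc = AllPairs.tabulate⁺-< (allPairs-tabulate⁻ asc)

    x-injective : ∀ {i k} → x i ≡ x k → i ≡ k
    x-injective {i} {k} xi≡xk = toℕ-injective (suc-injective
      (trans (sym (rank-sorted x-asc i))
        (trans (cong (rank (tabulate x)) xi≡xk) (rank-sorted x-asc k))))

    γ-injective : ∀ {i k} → γ ⟨$⟩ʳ i ≡ γ ⟨$⟩ʳ k → i ≡ k
    γ-injective γi≡γk = trans (sym (γγ _)) (trans (cong (γ ⟨$⟩ʳ_) γi≡γk) (γγ _))

    x∘γ↭x : tabulate (x ∘ (γ ⟨$⟩ʳ_)) ↭ tabulate x
    x∘γ↭x = ∼bag⇒↭ (unique∧set⇒bag
      (Unique.tabulate⁺ (γ-injective ∘ x-injective)) (Unique.tabulate⁺ x-injective)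
      (mk⇔ (λ v∈ → let i , v≡ = ∈-tabulate⁻ v∈ in
                    subst (_∈ₗ tabulate x) (sym v≡) (∈-tabulate⁺ (γ ⟨$⟩ʳ i)))
           (λ v∈ → let k , v≡ = ∈-tabulate⁻ v∈ in
                    subst (_∈ₗ tabulate (x ∘ (γ ⟨$⟩ʳ_)))
                      (sym (trans v≡ (cong x (sym (γγ k))))) (∈-tabulate⁺ (γ ⟨$⟩ʳ k)))))

  copy-length : ∀ {S : Pred Coord ℓ} {ds} → Copy S (oneLine γ) ds → length (map proj₂ ds) ≡ j
  copy-length {ds = ds} (copy _ _ pat) = trans (sym (length-map _ (map proj₂ ds)))
    (trans (cong length pat) (length-tabulate _))

  -- The γ-part consists of the entries of rank at most j, so it lies below the τ-part.
  copy-split : ∀ {τ} → All (j <_) τ → ∀ {S : Pred Coord ℓ} {ds} → Copy S (oneLine γ ++ τ) ds →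
               ∃₂ λ ds₁ ds₂ → ds ≡ ds₁ ++ ds₂ × Copy S (oneLine γ) ds₁ × Tail j S τ ds₂ ×
                 All (λ c → All (Above c) ds₂) ds₁
  copy-split τ> {ds = ds} (copy S-ds asc pat)
    with ds₁ , ds₂ , refl , pat₁ , pat₂ ← map≡++ (rank (map proj₂ ds) ∘ proj₂) ds (oneLine γ)
                                            (trans (map-∘ ds) pat)
    with asc₁ , asc₂ , x< ← ++-allPairs⁻ ds₁ asc
    = ds₁ , ds₂ , refl
    , copy₁
    , (All.++⁻ʳ ds₁ S-ds , asc₂ ,
       trans (cong (λ n → map (n +_) (pattern-of (map proj₂ ds₂))) (sym (copy-length copy₁)))
         (trans (sym (map-rank-upper ys₁≪ys₂)) (trans (restrict ds₂) pat₂)))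
    , above
    where
    w = map proj₂ ds

    restrict : ∀ ds′ → map (rank (map proj₂ ds₁ ++ map proj₂ ds₂)) (map proj₂ ds′) ≡
                       map (rank w ∘ proj₂) ds′
    restrict ds′ = trans (cong (λ w → map (rank w) (map proj₂ ds′)) (sym (map-++ proj₂ ds₁ ds₂)))
                         (sym (map-∘ ds′))

    lower : All (λ c → rank w (proj₂ c) ≤ j) ds₁
    lower = All.map⁻ (subst (All (_≤ j)) (sym pat₁) oneLine≤)

    upper : All (λ c → j < rank w (proj₂ c)) ds₂
    upper = All.map⁻ (subst (All (j <_)) (sym pat₂) τ>)

    above : All (λ c → All (Above c) ds₂) ds₁
    above = All.zipWith (λ (x<ds₂ , r≤j) →
        All.zipWith (λ (x< , j<r) → x< , rank-cancel-< w (≤-<-trans r≤j j<r)) (x<ds₂ , upper))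
      (x< , lower)

    ys₁≪ys₂ : map proj₂ ds₁ ≪ map proj₂ ds₂
    ys₁≪ys₂ = above⇒≪ above

    copy₁ : Copy _ (oneLine γ) ds₁
    copy₁ = copy (All.++⁻ˡ ds₁ S-ds) asc₁
      (trans (sym (map-rank-lower ys₁≪ys₂)) (trans (restrict ds₁) pat₁))

  -- The copy keeps its ranks because the tail lies above it, and the ranks of the tail rise by `j`,
  -- the shift built into `Tail`.
  copy-join : ∀ {τ} {S : Pred Coord ℓ} {ds₁ ds₂} → Copy S (oneLine γ) ds₁ → Tail j S τ ds₂ →
              All (λ c → All (Above c) ds₂) ds₁ → Copy S (oneLine γ ++ τ) (ds₁ ++ ds₂)
  copy-join {ds₁ = ds₁} {ds₂} copy₁@(copy S₁ asc₁ pat₁) (S₂ , asc₂ , pat₂) above =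
    copy (All.++⁺ S₁ S₂) (AllPairs.++⁺ asc₁ asc₂ (All.map (All.map proj₁) above)) (begin
      pattern-of (map proj₂ (ds₁ ++ ds₂))
        ≡⟨ cong pattern-of (map-++ proj₂ ds₁ ds₂) ⟩
      pattern-of (ys₁ ++ ys₂)
        ≡⟨ map-++ (rank (ys₁ ++ ys₂)) ys₁ ys₂ ⟩
      map (rank (ys₁ ++ ys₂)) ys₁ ++ map (rank (ys₁ ++ ys₂)) ys₂
        ≡⟨ cong₂ _++_ (map-rank-lower (above⇒≪ above)) (map-rank-upper (above⇒≪ above)) ⟩
      pattern-of ys₁ ++ map (length ys₁ +_) (pattern-of ys₂)
        ≡⟨ cong₂ _++_ pat₁ (trans (cong (λ n → map (n +_) (pattern-of ys₂)) (copy-length copy₁)) pat₂) ⟩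
      oneLine γ ++ _ ∎)
    where
    open ≡-Reasoning
    ys₁ = map proj₂ ds₁
    ys₂ = map proj₂ ds₂

-- Counting

¬¬-decidable : (P : Pred A ℓ) {xs : List A} → (∀ x → x ∈ₗ xs) → ¬ ¬ Decidable P
¬¬-decidable P {xs} ∈xs k = ¬¬-decidable-on P xs λ ds → k λ x → All.lookup ds (∈xs x)

module _ {P : Pred A ℓ} (P? : Decidable P) where

  length-filter-∁ : ∀ xs → length (filter P? xs) + length (filter (∁? P?) xs) ≡ length xs
  length-filter-∁ []       = refl
  length-filter-∁ (x ∷ xs) with P? x
  ... | yes _ = cong suc (length-filter-∁ xs)
  ... | no  _ = trans (+-suc _ _) (cong suc (length-filter-∁ xs))

  filter-filter : ∀ {Q : Pred A ℓ′} (Q? : Decidable Q) → P ⊆ Q →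
                  ∀ xs → filter P? (filter Q? xs) ≡ filter P? xs
  filter-filter Q? P⊆Q []       = refl
  filter-filter Q? P⊆Q (x ∷ xs) with Q? x
  ... | yes _  with P? x
  ...   | yes _ = cong (x ∷_) (filter-filter Q? P⊆Q xs)
  ...   | no  _ = filter-filter Q? P⊆Q xs
  filter-filter Q? P⊆Q (x ∷ xs) | no ¬Qx =
    trans (filter-filter Q? P⊆Q xs) (sym (filter-reject P? (¬Qx ∘ P⊆Q)))

module _ {_~_ : Rel A ℓ} (_~?_ : Binary.Decidable _~_)
         (~-refl : ∀ x → x ~ x) (~-joinʳ : ∀ x y z → x ~ z → y ~ z → x ~ y) where

  -- Induction removes the class of the first element from both lists. `~-refl` and `~-joinʳ` make
  -- the relation an equivalence, so the other classes stay intact. The bound `n` serves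
  -- termination, since the filtered list is not a subterm.
  length-by-classes : ∀ n xs ys → length xs ≤ n →
    (∀ x → x ∈ₗ xs ⊎ x ∈ₗ ys → length (filter (x ~?_) xs) ≡ length (filter (x ~?_) ys)) →
    length xs ≡ length ys
  length-by-classes _ [] [] _ _ = refl
  length-by-classes _ [] (y ∷ ys) _ classes = contradiction
    (trans (classes y (inj₂ (here refl))) (cong length (filter-accept (y ~?_) {xs = ys} (~-refl y)))) λ ()
  length-by-classes (suc n) (x ∷ xs) ys (s≤s xs≤n) classes = begin
    length (x ∷ xs)
      ≡⟨ length-filter-∁ (x ~?_) (x ∷ xs) ⟨
    length (filter (x ~?_) (x ∷ xs)) + length (others (x ∷ xs))
      ≡⟨ cong₂ _+_ (classes x (inj₁ (here refl)))
           (length-by-classes n (others (x ∷ xs)) (others ys) others≤n other-classes) ⟩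
    length (filter (x ~?_) ys) + length (others ys)
      ≡⟨ length-filter-∁ (x ~?_) ys ⟩
    length ys ∎
    where
    open ≡-Reasoning

    others : List A → List A
    others = filter (∁? (x ~?_))

    others≤n : length (others (x ∷ xs)) ≤ n
    others≤n = ≤-trans
      (≤-reflexive (cong length (filter-reject (∁? (x ~?_)) {xs = xs} λ ¬x~x → ¬x~x (~-refl x))))
      (≤-trans (length-filter (∁? (x ~?_)) xs) xs≤n)

    class-of-other : ∀ {z} → ¬ (x ~ z) → ∀ zs → filter (z ~?_) (others zs) ≡ filter (z ~?_) zs
    class-of-other {z} x≁z = filter-filter (z ~?_) (∁? (x ~?_)) λ {w} z~w x~w →
      x≁z (~-joinʳ x z w x~w z~w)

    other-classes : ∀ z → z ∈ₗ others (x ∷ xs) ⊎ z ∈ₗ others ys →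
      length (filter (z ~?_) (others (x ∷ xs))) ≡ length (filter (z ~?_) (others ys))
    other-classes z z∈ = trans (cong length (class-of-other x≁z (x ∷ xs)))
      (trans (classes z (Sum.map proj₁ proj₁ split))
             (sym (cong length (class-of-other x≁z ys))))
      where
      split = Sum.map (∈-filter⁻ (∁? (x ~?_)) {xs = x ∷ xs}) (∈-filter⁻ (∁? (x ~?_)) {xs = ys}) z∈
      x≁z = Sum.[ proj₂ , proj₂ ] split

HasCount-filter : ∀ {P : Pred A ℓ} {Q : Pred A ℓ′} (Q? : Decidable Q) {xs} →
                  Unique xs → (∀ x → x ∈ₗ xs ⇔ P x) →
                  HasCount (λ x → P x × Q x) (length (filter Q? xs))
HasCount-filter Q? {xs} xs! xs⇔P = filter Q? xs , Unique.filter⁺ Q? xs! ,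
  (λ x → mk⇔ (λ x∈ → let x∈xs , Qx = ∈-filter⁻ Q? {xs = xs} x∈ in to (xs⇔P x) x∈xs , Qx)
             (λ (Px , Qx) → ∈-filter⁺ Q? (from (xs⇔P x) Px) Qx)) ,
  refl

unique-map⁺ : ∀ {P : Pred A ℓ} {f : A → B} → (∀ {x y} → P x → P y → f x ≡ f y → x ≡ y) →
              ∀ {xs} → All P xs → Unique xs → Unique (map f xs)
unique-map⁺ f-inj []         []           = []
unique-map⁺ f-inj (Px ∷ Pxs) (x∉xs ∷ xs!) =
  All.map⁺ (All.zipWith (λ (Py , x≢y) → x≢y ∘ f-inj Px Py) (Pxs , x∉xs)) ∷
  unique-map⁺ f-inj Pxs xs!

HasCount-map : ∀ {P : Pred A ℓ} {Q : Pred B ℓ′} (f : A → B) →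
               (∀ {x y} → P x → P y → f x ≡ f y → x ≡ y) →
               (∀ {x} → P x → Q (f x)) → (∀ {y} → Q y → ∃ λ x → P x × f x ≡ y) →
               ∀ {n} → HasCount P n → HasCount Q n
HasCount-map {Q = Q} f f-inj f-pres f-surj (xs , xs! , xs⇔P , refl) =
  map f xs , unique-map⁺ f-inj (All.tabulate (to (xs⇔P _))) xs! ,
  (λ y → mk⇔ (λ y∈ → let x , x∈ , y≡fx = ∈-map⁻ f y∈ in
                      subst Q (sym y≡fx) (f-pres (to (xs⇔P x) x∈)))
             (λ Qy → let x , Px , fx≡y = f-surj Qy in
                     subst (_∈ₗ map f xs) fx≡y (∈-map⁺ f (from (xs⇔P x) Px)))) ,
  length-map f xs

-- Increasing enumerations of sets of numbers

record Enumeration (S : Pred ℕ ℓ) : Set ℓ where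
  field
    nth      : ℕ → ℕ
    -- Only the values on `S` are constrained.
    index    : ℕ → ℕ
    nth-mono : ∀ {i k} → i < k → nth i < nth k
    nth-∈    : ∀ i → S (nth i)
    index-nth : ∀ i → index (nth i) ≡ i
    nth-index : ∀ {x} → S x → nth (index x) ≡ x

  nth-mono-≤ : ∀ {i k} → i ≤ k → nth i ≤ nth k
  nth-mono-≤ i≤k with m≤n⇒m<n∨m≡n i≤k
  ... | inj₁ i<k  = <⇒≤ (nth-mono i<k)
  ... | inj₂ refl = ≤-refl

  nth-cancel-< : ∀ {i k} → nth i < nth k → i < k
  nth-cancel-< lt = ≰⇒> λ k≤i → <⇒≱ lt (nth-mono-≤ k≤i)

  nth-cancel-≤ : ∀ {i k} → nth i ≤ nth k → i ≤ k
  nth-cancel-≤ le = ≮⇒≥ λ k<i → ≤⇒≯ le (nth-mono k<i)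

  nth-injective : ∀ {i k} → nth i ≡ nth k → i ≡ k
  nth-injective eq = trans (sym (index-nth _)) (trans (cong index eq) (index-nth _))

  i≤nth : ∀ i → i ≤ nth i
  i≤nth zero    = z≤n
  i≤nth (suc i) = ≤-<-trans (i≤nth i) (nth-mono ≤-refl)

-- Recursion on the number of initial values still in doubt: membership of 0 is settled and `S`
-- shifted down by one, until `S` is all of ℕ and the identity enumerates it.
enumerate : ∀ {S : Pred ℕ ℓ} → Decidable S → ∀ n → (∀ {x} → n ≤ x → S x) → Enumeration S
enumerate S? zero    cofinite = record
  { nth       = λ i → i
  ; index     = λ x → x
  ; nth-mono  = λ lt → lt
  ; nth-∈     = λ _ → cofinite z≤n
  ; index-nth = λ _ → refl
  ; nth-index = λ _ → refl
  }
enumerate {S = S} S? (suc n) cofinite with S? 0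
... | yes S0 = record
  { nth       = λ { zero → 0 ; (suc i) → suc (nth i) }
  ; index     = λ { zero → 0 ; (suc x) → suc (index x) }
  ; nth-mono  = λ { {zero} {suc k} _ → z<s ; {suc i} {suc k} (s≤s lt) → s<s (nth-mono lt) }
  ; nth-∈     = λ { zero → S0 ; (suc i) → nth-∈ i }
  ; index-nth = λ { zero → refl ; (suc i) → cong suc (index-nth i) }
  ; nth-index = λ { {zero} _ → refl ; {suc x} Sx → cong suc (nth-index Sx) }
  }
  where open Enumeration (enumerate (S? ∘ suc) n (cofinite ∘ s≤s))
... | no ¬S0 = record
  { nth       = suc ∘ nth
  ; index     = λ { zero → 0 ; (suc x) → index x }
  ; nth-mono  = s<s ∘ nth-mono
  ; nth-∈     = nth-∈
  ; index-nth = index-nth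
  ; nth-index = λ { {zero} S0 → contradiction S0 ¬S0 ; {suc x} Sx → cong suc (nth-index Sx) }
  }
  where open Enumeration (enumerate (S? ∘ suc) n (cofinite ∘ s≤s))

-- Shading

-- The default 0 agrees with `Contains`, whose last condition is thus `corner ds ∈ₛ μ` by
-- definition.
corner : List Coord → Coord
corner ds = max 0 (map proj₁ ds) , max 0 (map proj₂ ds)

within-corner : ∀ ds → All (Within (corner ds)) ds
within-corner ds = All.zip (All.map⁻ (xs≤max 0 (map proj₁ ds)) , All.map⁻ (xs≤max 0 (map proj₂ ds)))

corner-least : ∀ {c ds} → All (Within c) ds → Within c (corner ds)
corner-least w = max≤v⁺ z≤n (All.map⁺ (All.map proj₁ w)) , max≤v⁺ z≤n (All.map⁺ (All.map proj₂ w))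

within-trans : ∀ {c d e} → Within c d → Within d e → Within c e
within-trans (dx≤ , dy≤) (ex≤ , ey≤) = ≤-trans ex≤ dx≤ , ≤-trans ey≤ dy≤

within⇒above : ∀ {c d e} → Within c d → Above c e → Above d e
within⇒above (dx≤ , dy≤) (<ex , <ey) = ≤-<-trans dx≤ <ex , ≤-<-trans dy≤ <ey

Positive : Pred Coord _
Positive (x , y) = 1 ≤ x × 1 ≤ y

-- Occurrences inside a shape and symmetric full placements

module _ (μ : Shape) (p : Filling μ) where

  dot-positive : ∀ {c} → Dot μ p c → Positive c
  dot-positive d = ∈ₛ-positive μ (Dot⇒∈ₛ μ p d)

  copy-corner-positive : ∀ {σ} → 1 ≤ length σ → ∀ {ds} → Copy (Dot μ p) σ ds → Positive (corner ds)
  copy-corner-positive 1≤σ {[]}     (copy _ _ refl) = contradiction 1≤σ λ ()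
  copy-corner-positive _   {d ∷ ds} (copy (Pd ∷ _) _ _)
    with (dx≤ , dy≤) ∷ _ ← within-corner (d ∷ ds) | 1≤x , 1≤y ← dot-positive Pd =
    ≤-trans 1≤x dx≤ , ≤-trans 1≤y dy≤

  -- Any box of the shape that bounds the dots will do: the corner lies within it, and a nonempty
  -- pattern keeps the corner positive.
  copy⇒contains : ∀ {σ} → 1 ≤ length σ → ∀ {ds c} → Copy (Dot μ p) σ ds →
                  All (Within c) ds → c ∈ₛ μ → Contains μ p σ
  copy⇒contains 1≤σ {ds} σ-copy@(copy S-ds asc pat) w c∈μ
    with 1≤X , 1≤Y ← copy-corner-positive 1≤σ σ-copy | X≤ , Y≤ ← corner-least w =
    ds , S-ds , Linked.AllPairs⇒Linked asc , pat , ∈ₛ-down μ 1≤X 1≤Y X≤ Y≤ c∈μ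

  contains⇒copy : ∀ {σ} → Contains μ p σ → ∃ λ ds → Copy (Dot μ p) σ ds × corner ds ∈ₛ μ
  contains⇒copy (ds , S-ds , linked , pat , c∈μ) =
    ds , copy S-ds (Linked.Linked⇒AllPairs <-trans linked) pat , c∈μ

-- Only rows are recorded, since `reflect` carries each condition over to columns.
record SymmetricFull (μ : Shape) (p : Filling μ) : Set where
  field
    row-unique : ∀ {x x′ y} → Dot μ p (x , y) → Dot μ p (x′ , y) → x ≡ x′
    row-dot    : ∀ {x y} → (x , y) ∈ₛ μ → ∃ λ x′ → Dot μ p (x′ , y)
    reflect    : ∀ {c} → Dot μ p c → Dot μ p (swap c)

toSymmetricFull : ∀ {μ p} → IsPlacement μ p → IsFull μ p → IsSymmetric μ p → SymmetricFull μ p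
toSymmetricFull pl full p-sym = record
  { row-unique = IsPlacement.row-unique pl
  ; row-dot    = λ c∈μ → let x , d , _ = IsFull.row-full full c∈μ in x , d
  ; reflect    = to (p-sym _ _)
  }

module _ {μ} (μ-conj : SelfConjugate μ) {p} (p-full : SymmetricFull μ p) where
  open SymmetricFull p-full

  toIsPlacement : IsPlacement μ p
  toIsPlacement = record
    { row-unique = row-unique
    ; col-unique = λ d d′ → row-unique (reflect d) (reflect d′)
    }

  toIsFull : IsFull μ p
  toIsFull = record
    { row-full = λ c∈μ → let x , d = row-dot c∈μ in x , d , row-unique d
    ; col-full = λ c∈μ → let y , d = row-dot (to (μ-conj _ _) c∈μ) in
                         y , reflect d , λ d′ → row-unique d (reflect d′)
    }

  toIsSymmetric : IsSymmetric μ p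
  toIsSymmetric x y = mk⇔ reflect reflect

-- `R` holds the words that follow the prefix. No prefix enters the definition of the shaded region,
-- so it is the same for α and β.
module Shading {ℓ} (μ : Shape) (μ-conj : SelfConjugate μ) (j : ℕ) (1≤j : 1 ≤ j)
               (R : Pred Word ℓ) (R> : ∀ {τ} → R τ → All (j <_) τ) where

  height : ℕ
  height = length (rows μ)

  -- The box `d` of `μ` puts `c` and the tail in a common rectangle. An empty word in `R` shades all
  -- of `μ`, which covers the pattern consisting of the prefix alone.
  Tailed : Filling μ → Pred Coord ℓ
  Tailed p c = Positive c × ∃ λ τ → R τ × ∃₂ λ ds d →
    Tail j (Dot μ p) τ ds × All (Above c) ds × All (Within d) ds × Within d c × d ∈ₛ μ

  -- The second disjunct makes the shaded region symmetric without mentioning inverse patterns.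
  Shaded : Filling μ → Pred Coord ℓ
  Shaded p c = Tailed p c ⊎ Tailed p (swap c)

  module _ (p : Filling μ) where

    shaded-swap : ∀ {c} → Shaded p c → Shaded p (swap c)
    shaded-swap = Sum.swap

    tailed-down : ∀ {c d} → Positive d → Within c d → Tailed p c → Tailed p d
    tailed-down 1≤d d≤c (_ , τ , Rτ , ds , e , τ-tail , c<ds , ds≤e , c≤e , e∈μ) =
      1≤d , τ , Rτ , ds , e , τ-tail , All.map (within⇒above d≤c) c<ds , ds≤e , within-trans c≤e d≤c , e∈μ

    shaded-down : ∀ {c d} → Positive d → Within c d → Shaded p c → Shaded p d
    shaded-down 1≤d d≤c =
      Sum.map (tailed-down 1≤d d≤c) (tailed-down (swap 1≤d) (swap d≤c))

    tailed⇒∈ₛ : ∀ {c} → Tailed p c → c ∈ₛ μ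
    tailed⇒∈ₛ ((1≤x , 1≤y) , _ , _ , _ , _ , _ , _ , _ , (x≤ , y≤) , e∈μ) =
      ∈ₛ-down μ 1≤x 1≤y x≤ y≤ e∈μ

    shaded⇒∈ₛ : ∀ {c} → Shaded p c → c ∈ₛ μ
    shaded⇒∈ₛ (inj₁ t) = tailed⇒∈ₛ t
    shaded⇒∈ₛ (inj₂ t) = to (μ-conj _ _) (tailed⇒∈ₛ t)

    shaded-positive : ∀ {c} → Shaded p c → Positive c
    shaded-positive s = ∈ₛ-positive μ (shaded⇒∈ₛ s)

    shaded-bounded : ∀ {x y} → Shaded p (x , y) → x ≤ height × y ≤ height
    shaded-bounded s = ∈ₛ⇒≤height μ (shaded⇒∈ₛ (shaded-swap s)) , ∈ₛ⇒≤height μ (shaded⇒∈ₛ s)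

    -- `R` is arbitrary, hence the double negation. Shaded boxes lie in `μ`, and by self-conjugacy
    -- both coordinates are at most `height`, so only finitely many boxes have to be decided.
    ¬¬-shaded? : ¬ ¬ Decidable (Shaded p)
    ¬¬-shaded? k = ¬¬-decidable-on (Shaded p) (cartesianProduct range range) λ ds →
      k λ c → decide ds c (c ∈ₛ? μ)
      where
      range = upTo (suc height)

      decide : All (Dec ∘ Shaded p) (cartesianProduct range range) → ∀ c → Dec (c ∈ₛ μ) → Dec (Shaded p c)
      decide ds c (no c∉μ)  = no (c∉μ ∘ shaded⇒∈ₛ)
      decide ds c (yes c∈μ) = All.lookup ds (∈-cartesianProduct⁺
        (∈-upTo⁺ (s≤s (∈ₛ⇒≤height μ (to (μ-conj _ _) c∈μ)))) (∈-upTo⁺ (s≤s (∈ₛ⇒≤height μ c∈μ))))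

  tailed-transfer : ∀ p q {c} → (∀ {d} → Above c d → Dot μ p d → Dot μ q d) →
                    Tailed p c → Tailed q c
  tailed-transfer p q p⇒q (1≤c , τ , Rτ , ds , e , (p-ds , tail) , c<ds , rest) =
    1≤c , τ , Rτ , ds , e , (All.zipWith (uncurry p⇒q) (c<ds , p-ds) , tail) , c<ds , rest

  AgreeOutside : (p q : Filling μ) → Set ℓ
  AgreeOutside p q = ∀ c → ¬ Shaded p c → Dot μ p c ⇔ Dot μ q c

  -- The tail above a shaded box that is maximal on its diagonal consists of unshaded dots,
  -- so the unshaded dots determine the shaded region.
  module _ (p q : Filling μ) (shaded? : Decidable (Shaded p)) (p≈q : AgreeOutside p q) where

    shaded-climb : ∀ n {x y} → height < n + y → Shaded p (x , y) → Shaded q (x , y)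
    shaded-climb zero    h<y s = contradiction (proj₂ (shaded-bounded p s)) (<⇒≱ h<y)
    shaded-climb (suc n) {x} {y} h<n+y s with shaded? (suc x , suc y)
    ... | yes s′ = shaded-down q (shaded-positive p s) (n≤1+n x , n≤1+n y)
                     (shaded-climb n (subst (height <_) (sym (+-suc n y)) h<n+y) s′)
    ... | no ¬s′ = Sum.map
      (tailed-transfer p q λ above → to (p≈q _ (¬s′ ∘ shaded-down p (z<s , z<s) above)))
      (tailed-transfer p q λ above → to (p≈q _ (¬s′ ∘ shaded-swap p ∘ shaded-down p (z<s , z<s) above)))
      s

    shaded-invariant : ∀ c → Shaded p c ⇔ Shaded q c
    shaded-invariant c = mk⇔ (shaded-climb (suc height) (m≤m+n _ _)) back
      where
      -- If `c` is unshaded for `p`, so is every box beyond it, and the placements agree on the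
      -- whole tail.
      lower : ∀ {c} → ¬ Shaded p c → Tailed q c → Tailed p c
      lower ¬s t@(1≤c , _) = tailed-transfer q p
        (λ above → from (p≈q _ (¬s ∘ shaded-down p 1≤c (<⇒≤ (proj₁ above) , <⇒≤ (proj₂ above))))) t

      back : Shaded q c → Shaded p c
      back s with shaded? c
      ... | yes s′ = s′
      ... | no ¬s′ = Sum.map (lower ¬s′) (lower (¬s′ ∘ shaded-swap p)) s

  infix 4 _~_
  -- Agreement is measured outside the region of `p`; carrying equality of the regions along makes
  -- the relation evidently symmetric.
  _~_ : Rel (Filling μ) ℓ
  p ~ q = (∀ c → Shaded p c ⇔ Shaded q c) × AgreeOutside p q

  ~-refl : ∀ p → p ~ p
  ~-refl p = (λ _ → mk⇔ (λ s → s) (λ s → s)) , λ _ _ → mk⇔ (λ d → d) (λ d → d)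

  ~-joinʳ : ∀ p q r → p ~ r → q ~ r → p ~ q
  ~-joinʳ p q r (sp , dp) (sq , dq) =
    (λ c → ⇔-sym (sq c) ⇔-∘ sp c) ,
    λ c ¬s → ⇔-sym (dq c (¬s ∘ from (sp c) ∘ to (sq c))) ⇔-∘ dp c ¬s

  -- Occurrences of extended patterns and shaded copies of the prefix

  module _ (γ : Permutation′ j) where

    1≤γ++ : ∀ τ → 1 ≤ length (oneLine γ ++ τ)
    1≤γ++ τ = ≤-trans 1≤j (≤-trans (≤-reflexive (sym (length-tabulate _)))
      (≤-trans (m≤m+n _ _) (≤-reflexive (sym (length-++ (oneLine γ))))))

    1≤γ : 1 ≤ length (oneLine γ)
    1≤γ = subst (1 ≤_) (sym (length-tabulate _)) 1≤j

    module _ (p : Filling μ) where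

      -- The copy is within `c` and the tail strictly beyond `c`, so the two concatenate; the box
      -- `e` bounds both.
      tailed-copy⇒contains : ∀ {ds c} → Copy (Dot μ p) (oneLine γ) ds → All (Within c) ds → Tailed p c →
                             ∃ λ τ → R τ × Contains μ p (oneLine γ ++ τ)
      tailed-copy⇒contains γ-copy ds≤c (_ , τ , Rτ , ds′ , e , τ-tail , c<ds′ , ds′≤e , c≤e , e∈μ) =
        τ , Rτ , copy⇒contains μ p (1≤γ++ τ)
          (copy-join γ γ-copy τ-tail (All.map (λ d≤c → All.map (within⇒above d≤c) c<ds′) ds≤c))
          (All.++⁺ (All.map (within-trans c≤e) ds≤c) ds′≤e) e∈μ

      -- A tail over the mirror image of `c` fits the reflected copy, which lies within that mirror
      -- image.
      shaded-copy⇒contains : Involutive _≡_ (γ ⟨$⟩ʳ_) → (∀ {c} → Dot μ p c → Dot μ p (swap c)) →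
                             ∀ {ds c} → Copy (Dot μ p) (oneLine γ) ds → All (Within c) ds → Shaded p c →
                             ∃ λ τ → R τ × Contains μ p (oneLine γ ++ τ)
      shaded-copy⇒contains γγ p-sym γ-copy ds≤c (inj₁ t) = tailed-copy⇒contains γ-copy ds≤c t
      shaded-copy⇒contains γγ p-sym γ-copy ds≤c (inj₂ t)
        with ds′ , γ-copy′ , w ← copy-reflect γ γγ p-sym γ-copy =
        tailed-copy⇒contains γ-copy′ (w ds≤c) t

      -- The tail lies strictly beyond the corner of the prefix part, and the corner of the whole
      -- occurrence witnesses the common rectangle.
      contains⇒shaded-copy : ∀ {τ} → R τ → Contains μ p (oneLine γ ++ τ) →
                             ∃ λ ds → Copy (Dot μ p) (oneLine γ) ds × Shaded p (corner ds)
      contains⇒shaded-copy {τ} Rτ contains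
        with ds , γτ-copy , c∈μ ← contains⇒copy μ p contains
        with ds₁ , ds₂ , refl , γ-copy , τ-tail , above ← copy-split γ (R> Rτ) γτ-copy
        = ds₁ , γ-copy , inj₁
          ( copy-corner-positive μ p 1≤γ γ-copy
          , τ , Rτ , ds₂ , corner (ds₁ ++ ds₂) , τ-tail
          -- The maxima start from the default 0, so a strict bound also uses that the tail dot has
          -- positive coordinates.
          , All.zipWith (λ (d , ds₁<d) → let 1≤x , 1≤y = dot-positive μ p d in
              max<v⁺ 1≤x (All.map⁺ (All.map proj₁ ds₁<d)) ,
              max<v⁺ 1≤y (All.map⁺ (All.map proj₂ ds₁<d)))
              (proj₁ τ-tail , All.All-swap above)
          , All.++⁻ʳ ds₁ (within-corner (ds₁ ++ ds₂))
          , corner-least (All.++⁻ˡ ds₁ (within-corner (ds₁ ++ ds₂)))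
          , c∈μ )

-- Deleting the rows and columns of the unshaded dots

module Expansion {ℓ} {S : Pred ℕ ℓ} (enumeration : Enumeration S) where

  open Enumeration enumeration public

  -- One enumeration serves both directions: dots and shaded region are symmetric, so the same
  -- indices are deleted among rows and columns.
  expand : Coord → Coord
  expand (i , k) = nth i , nth k

  compress : Coord → Coord
  compress (x , y) = index x , index y

  expand-within : ∀ {c d} → Within c d → Within (expand c) (expand d)
  expand-within (x≤ , y≤) = nth-mono-≤ x≤ , nth-mono-≤ y≤

  expand-within⁻ : ∀ {c d} → Within (expand c) (expand d) → Within c d
  expand-within⁻ (x≤ , y≤) = nth-cancel-≤ x≤ , nth-cancel-≤ y≤

  compress-expand : ∀ c → compress (expand c) ≡ c
  compress-expand (i , k) = cong₂ _,_ (index-nth i) (index-nth k)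

module Compression {ℓ} (μ : Shape) (μ-conj : SelfConjugate μ) (j : ℕ) (1≤j : 1 ≤ j)
                   (R : Pred Word ℓ) (R> : ∀ {τ} → R τ → All (j <_) τ) where

  open Shading μ μ-conj j 1≤j R R>

  module _ (p₀ : Filling μ) where

    private
      D : Pred Coord ℓ
      D = Shaded p₀

    -- Rows and columns without a dot of p₀ outside the shaded region; this includes all indices
    -- outside μ, so that there are infinitely many.
    Active : Pred ℕ ℓ
    Active y = ∀ x → Dot μ p₀ (x , y) → D (x , y)

    -- Coordinates start at 1, so row 0 has no dot. This forces `nth 0` to be 0, and positive
    -- indices then match positive coordinates.
    active-0 : Active 0
    active-0 x d = contradiction (proj₂ (dot-positive μ p₀ d)) λ ()

    module _ (p₀-full : SymmetricFull μ p₀) (shaded? : Decidable D) where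

      private
        module P₀ = SymmetricFull p₀-full

      -- A row of `μ` has a single dot, so testing that dot settles the quantifier; other rows have
      -- none.
      active? : Decidable Active
      active? y with (1 , y) ∈ₛ? μ
      ... | no ∉μ = yes λ x d → contradiction
        (∈ₛ-down μ ≤-refl (proj₂ (dot-positive μ p₀ d)) (proj₁ (dot-positive μ p₀ d)) ≤-refl
          (Dot⇒∈ₛ μ p₀ d)) ∉μ
      ... | yes ∈μ with x , d ← P₀.row-dot ∈μ with shaded? (x , y)
      ...   | yes s = yes λ x′ d′ → subst (λ x → D (x , y)) (P₀.row-unique d d′) s
      ...   | no ¬s = no λ active → ¬s (active x d)

      enumeration : Enumeration Active
      enumeration = enumerate active? (suc height)
        λ h<y x d → contradiction (∈ₛ⇒≤height μ (Dot⇒∈ₛ μ p₀ d)) (<⇒≱ h<y)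

  module _ (p₀ : Filling μ) (p₀-full : SymmetricFull μ p₀) (shaded? : Decidable (Shaded p₀))
           (active : Enumeration (Active p₀)) where

    open Expansion active

    private
      D : Pred Coord ℓ
      D = Shaded p₀

    nth-0 : nth 0 ≡ 0
    nth-0 = n≤0⇒n≡0 (subst (nth 0 ≤_) (nth-index (active-0 p₀)) (nth-mono-≤ {k = index 0} z≤n))

    nth-positive : ∀ {i} → 1 ≤ i → 1 ≤ nth i
    nth-positive 1≤i = ≤-<-trans z≤n (nth-mono 1≤i)

    nth-positive⁻ : ∀ {i} → 1 ≤ nth i → 1 ≤ i
    nth-positive⁻ 1≤e = nth-cancel-< (subst (_< nth _) (sym nth-0) 1≤e)

    -- Pulling the region back along `expand` keeps it downward closed and bounded, because `nth` is
    -- increasing and dominates the identity.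
    compressedShape : ∃ λ ν → ∀ c → c ∈ₛ ν ⇔ D (expand c)
    compressedShape = shape , λ c → mk⇔ ∈-shape⁻ ∈-shape⁺
      where
      shaded-expand? : Decidable (D ∘ expand)
      shaded-expand? c = shaded? (expand c)

      positive-expand : ∀ {i k} → D (expand (i , k)) → 1 ≤ i × 1 ≤ k
      positive-expand s = let 1≤x , 1≤y = shaded-positive p₀ s in
        nth-positive⁻ 1≤x , nth-positive⁻ 1≤y

      down-expand : ∀ {i k i′ k′} → 1 ≤ i′ → 1 ≤ k′ → i′ ≤ i → k′ ≤ k →
                    D (expand (i , k)) → D (expand (i′ , k′))
      down-expand 1≤i′ 1≤k′ i′≤i k′≤k = shaded-down p₀ (nth-positive 1≤i′ , nth-positive 1≤k′)
        (nth-mono-≤ i′≤i , nth-mono-≤ k′≤k)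

      bounded-expand : ∀ {i k} → D (expand (i , k)) → i ≤ height × k ≤ height
      bounded-expand s = let x≤h , y≤h = shaded-bounded p₀ s in
        ≤-trans (i≤nth _) x≤h , ≤-trans (i≤nth _) y≤h

      open ShapeOf shaded-expand? positive-expand down-expand height bounded-expand

  module Class (p₀ : Filling μ) (p₀-full : SymmetricFull μ p₀) (shaded? : Decidable (Shaded p₀))
               (active : Enumeration (Active p₀)) (ν : Shape)
               (∈ν⇔ : ∀ c → c ∈ₛ ν ⇔ Shaded p₀ (Expansion.expand active c)) where

    open Expansion active

    private
      module P₀ = SymmetricFull p₀-full

      D : Pred Coord ℓ
      D = Shaded p₀

    ∈ν⁺ : ∀ {c} → D (expand c) → c ∈ₛ ν
    ∈ν⁺ = from (∈ν⇔ _)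

    ∈ν⁻ : ∀ {c} → c ∈ₛ ν → D (expand c)
    ∈ν⁻ = to (∈ν⇔ _)

    ν-conj : SelfConjugate ν
    ν-conj x y = mk⇔ flip-∈ flip-∈
      where
      flip-∈ : ∀ {x y} → (x , y) ∈ₛ ν → (y , x) ∈ₛ ν
      flip-∈ c∈ν = ∈ν⁺ (shaded-swap p₀ (∈ν⁻ c∈ν))

    shrink : Filling μ → Filling ν
    shrink q = fill ν {P = Dot μ q ∘ expand} (λ c → Dot? μ q (expand c))

    dot-shrink⁺ : ∀ q {c} → D (expand c) → Dot μ q (expand c) → Dot ν (shrink q) c
    dot-shrink⁺ q s d = Dot-fill⁺ ν (λ c → Dot? μ q (expand c)) (∈ν⁺ s) d

    dot-shrink⁻ : ∀ q {c} → Dot ν (shrink q) c → D (expand c) × Dot μ q (expand c)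
    dot-shrink⁻ q d = ∈ν⁻ (Dot⇒∈ₛ ν (shrink q) d) , Dot-fill⁻ ν (λ c → Dot? μ q (expand c)) d

    module InClass (q : Filling μ) (q-full : SymmetricFull μ q) (p₀~q : p₀ ~ q) where

      private
        module Q = SymmetricFull q-full

      -- An unshaded dot of `p₀` in this row would also be a dot of `q`, but the only dot of `q`
      -- there is shaded.
      shaded-row-active : ∀ {x y} → Dot μ q (x , y) → D (x , y) → Active p₀ y
      shaded-row-active {x} {y} d s x′ d′ with shaded? (x′ , y)
      ... | yes s′ = s′
      ... | no ¬s′ = subst (λ x → D (x , y))
        (Q.row-unique d (to (proj₂ p₀~q (x′ , y) ¬s′) d′)) s

      expand-compress : ∀ {c} → Dot μ q c → D c → expand (compress c) ≡ c
      expand-compress d s = cong₂ _,_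
        -- Column `x` is handled as row `x` of the reflected dot.
        (nth-index (shaded-row-active (Q.reflect d) (shaded-swap p₀ s)))
        (nth-index (shaded-row-active d s))

      -- An unshaded dot of `q` is a dot of `p₀`, which an active row forbids.
      active-dot-shaded : ∀ {x y} → Active p₀ y → Dot μ q (x , y) → D (x , y)
      active-dot-shaded {x} {y} active d with shaded? (x , y)
      ... | yes s = s
      ... | no ¬s = active x (from (proj₂ p₀~q (x , y) ¬s) d)

      dot-compress : ∀ {c} → Dot μ q c → D c → Dot ν (shrink q) (compress c)
      dot-compress d s = dot-shrink⁺ q (subst D (sym (expand-compress d s)) s)
        (subst (Dot μ q) (sym (expand-compress d s)) d)

      shrink-full : SymmetricFull ν (shrink q)
      shrink-full = record
        { row-unique = λ d d′ → nth-injective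
            (Q.row-unique (proj₂ (dot-shrink⁻ q d)) (proj₂ (dot-shrink⁻ q d′)))
        ; row-dot = λ {_} {k} c∈ν →
            let x , d = Q.row-dot (shaded⇒∈ₛ p₀ (∈ν⁻ c∈ν))
                s     = active-dot-shaded (nth-∈ k) d
            in index x , subst (λ k → Dot ν (shrink q) (index x , k)) (index-nth k) (dot-compress d s)
        ; reflect = λ d → let s , d′ = dot-shrink⁻ q d in
            dot-shrink⁺ q (shaded-swap p₀ s) (Q.reflect d′)
        }

      module _ (γ : Permutation′ j) where

        -- The prefix part lies within a shaded corner, so all its dots are shaded and survive
        -- compression, which preserves their order.
        contains⇒shrink-contains : ∀ {τ} → R τ → Contains μ q (oneLine γ ++ τ) →
                                   Contains ν (shrink q) (oneLine γ)
        contains⇒shrink-contains Rτ contains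
          with ds , copy dots asc pat , s ← contains⇒shaded-copy γ q Rτ contains
          = copy⇒contains ν (shrink q) (1≤γ γ)
              (copy (All.map⁺ (All.zipWith (uncurry dot-compress) (dots , shaded)))
                    (AllPairs.map nth-cancel-< (AllPairs.map⁻ (subst (AllPairs _) ds≡ asc)))
                    (begin
                      pattern-of (map proj₂ ds′)           ≡⟨ pattern-of-map nth-mono-≤ nth-cancel-≤ _ ⟨
                      pattern-of (map nth (map proj₂ ds′)) ≡⟨ cong pattern-of (map-∘ ds′) ⟨
                      pattern-of (map (proj₂ ∘ expand) ds′) ≡⟨ cong pattern-of (map-∘ ds′) ⟩
                      pattern-of (map proj₂ (map expand ds′)) ≡⟨ cong (pattern-of ∘ map proj₂) ds≡ ⟨
                      pattern-of (map proj₂ ds)            ≡⟨ pat ⟩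
                      oneLine γ ∎))
              (All.map⁺ (All.zipWith
                (λ (d≤c , d≡) → expand-within⁻ (subst₂ Within (sym corner≡) (sym d≡) d≤c))
                (within-corner ds , expand≡)))
              (∈ν⁺ (subst D (sym corner≡) s₀))
          where
          open ≡-Reasoning
          ds′ = map compress ds

          s₀ : D (corner ds)
          s₀ = from (proj₁ p₀~q (corner ds)) s

          shaded : All D ds
          shaded = All.zipWith
            (λ (d , d≤c) → shaded-down p₀ (dot-positive μ q d) d≤c s₀) (dots , within-corner ds)

          expand≡ : All (λ c → expand (compress c) ≡ c) ds
          expand≡ = All.zipWith (uncurry expand-compress) (dots , shaded)

          ds≡ : ds ≡ map expand ds′
          ds≡ = trans (sym (map-id-local expand≡)) (map-∘ ds)

          nth-index-0 : nth (index 0) ≡ 0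
          nth-index-0 = nth-index (active-0 p₀)

          -- Each coordinate of the corner is 0 or a coordinate of a dot, and `nth ∘ index` fixes
          -- all of these.
          corner≡ : expand (compress (corner ds)) ≡ corner ds
          corner≡ = cong₂ _,_
            (argmax-all id {P = λ x → nth (index x) ≡ x} nth-index-0
              (All.map⁺ (All.map (cong proj₁) expand≡)))
            (argmax-all id {P = λ y → nth (index y) ≡ y} nth-index-0
              (All.map⁺ (All.map (cong proj₂) expand≡)))

        -- The expanded copy lies within the expanded corner, which is shaded because the corner
        -- lies in `ν`; so a tail can be appended.
        shrink-contains⇒contains : Involutive _≡_ (γ ⟨$⟩ʳ_) → Contains ν (shrink q) (oneLine γ) →
                                   ∃ λ τ → R τ × Contains μ q (oneLine γ ++ τ)
        shrink-contains⇒contains γγ contains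
          with ds , copy dots asc pat , c∈ν ← contains⇒copy ν (shrink q) contains
          = shaded-copy⇒contains γ q γγ Q.reflect
              (copy (All.map⁺ (All.map (proj₂ ∘ dot-shrink⁻ q) dots))
                    (AllPairs.map⁺ (AllPairs.map nth-mono asc))
                    (begin
                      pattern-of (map proj₂ (map expand ds)) ≡⟨ cong pattern-of (map-∘ ds) ⟨
                      pattern-of (map (proj₂ ∘ expand) ds)   ≡⟨ cong pattern-of (map-∘ ds) ⟩
                      pattern-of (map nth (map proj₂ ds))    ≡⟨ pattern-of-map nth-mono-≤ nth-cancel-≤ _ ⟩
                      pattern-of (map proj₂ ds)              ≡⟨ pat ⟩
                      oneLine γ ∎))
              (All.map⁺ (All.map expand-within (within-corner ds)))
              (to (proj₁ p₀~q (expand (corner ds))) (∈ν⁻ c∈ν))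
          where open ≡-Reasoning

    -- Unshaded dots are those of `p₀` for the whole class, and shaded dots are recovered from their
    -- compressed images.
    shrink-injective : ∀ {q q′} → SymmetricFull μ q × p₀ ~ q → SymmetricFull μ q′ × p₀ ~ q′ →
                       shrink q ≡ shrink q′ → q ≡ q′
    shrink-injective {q} {q′} (q-full , p₀~q) (q′-full , p₀~q′) eq =
      Filling-ext μ q q′ λ c → mk⇔ (transfer q-full p₀~q p₀~q′ eq c)
                                   (transfer q′-full p₀~q′ p₀~q (sym eq) c)
      where
      transfer : ∀ {q q′} → SymmetricFull μ q → p₀ ~ q → p₀ ~ q′ → shrink q ≡ shrink q′ →
                 ∀ c → Dot μ q c → Dot μ q′ c
      transfer {q} {q′} q-full p₀~q p₀~q′ eq c d with shaded? c
      ... | no ¬s = to (proj₂ p₀~q′ c ¬s) (from (proj₂ p₀~q c ¬s) d)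
      ... | yes s = subst (Dot μ q′) (expand-compress d s)
        (proj₂ (dot-shrink⁻ q′ (subst (λ r → Dot ν r (compress c)) eq (dot-compress d s))))
        where open InClass q q-full p₀~q

    module Expand (r : Filling ν) (r-full : SymmetricFull ν r) where

      private
        module R = SymmetricFull r-full

      -- The equation is a decidable way to say that both coordinates are active.
      Inner : Pred Coord _
      Inner c = expand (compress c) ≡ c × Dot ν r (compress c)

      Expanded : Pred Coord ℓ
      Expanded c = (¬ D c × Dot μ p₀ c) ⊎ Inner c

      expanded? : Decidable Expanded
      expanded? c@(x , y) = (¬? (shaded? c) ×-dec Dot? μ p₀ c) ⊎-dec
        (map′ (uncurry (cong₂ _,_)) (λ eq → cong proj₁ eq , cong proj₂ eq)
           ((nth (index x) ≟ x) ×-dec (nth (index y) ≟ y))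
         ×-dec Dot? ν r (compress c))

      grow : Filling μ
      grow = fill μ expanded?

      inner-shaded : ∀ {c} → Inner c → D c
      inner-shaded (eq , d) = subst D eq (∈ν⁻ (Dot⇒∈ₛ ν r d))

      inner-active : ∀ {x y} → Inner (x , y) → Active p₀ y
      inner-active {y = y} (eq , _) = subst (Active p₀) (cong proj₂ eq) (nth-∈ (index y))

      inner-expand : ∀ {c} → Dot ν r c → Inner (expand c)
      inner-expand {c} d =
        cong expand (compress-expand c) , subst (Dot ν r) (sym (compress-expand c)) d

      dot-grow⁻ : ∀ {c} → Dot μ grow c → Expanded c
      dot-grow⁻ = Dot-fill⁻ μ expanded?

      dot-grow⁺ : ∀ {c} → Expanded c → Dot μ grow c
      dot-grow⁺ {c} x@(inj₁ (_ , d)) = Dot-fill⁺ μ expanded? (Dot⇒∈ₛ μ p₀ d) x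
      dot-grow⁺ {c} x@(inj₂ inner)   = Dot-fill⁺ μ expanded? (shaded⇒∈ₛ p₀ (inner-shaded inner)) x

      -- The mixed cases cannot occur: inner dots sit in active rows, where `p₀` has no unshaded
      -- dot.
      expanded-unique : ∀ {x x′ y} → Expanded (x , y) → Expanded (x′ , y) → x ≡ x′
      expanded-unique (inj₁ (_ , d)) (inj₁ (_ , d′)) = P₀.row-unique d d′
      expanded-unique (inj₁ (¬s , d)) (inj₂ i′) = contradiction (inner-active i′ _ d) ¬s
      expanded-unique (inj₂ i) (inj₁ (¬s′ , d′)) = contradiction (inner-active i _ d′) ¬s′
      expanded-unique (inj₂ (eq , d)) (inj₂ (eq′ , d′)) = trans (sym (cong proj₁ eq))
        (trans (cong nth (R.row-unique d d′)) (cong proj₁ eq′))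

      expanded-dot : ∀ {x y} → (x , y) ∈ₛ μ → ∃ λ x′ → Expanded (x′ , y)
      expanded-dot {y = y} c∈μ with x , d ← P₀.row-dot c∈μ with shaded? (x , y)
      ... | no ¬s = x , inj₁ (¬s , d)
      ... | yes s =
        -- `p₀` belongs to its own class, so its shaded dot shows that this row meets `ν`, where `r`
        -- has a dot.
        let eq    = InClass.expand-compress p₀ p₀-full (~-refl p₀) d s
            i , e = R.row-dot (∈ν⁺ (subst D (sym eq) s))
        in nth i , subst (λ y → Expanded (nth i , y)) (cong proj₂ eq) (inj₂ (inner-expand e))

      expanded-swap : ∀ {c} → Expanded c → Expanded (swap c)
      expanded-swap (inj₁ (¬s , d)) = inj₁ (¬s ∘ shaded-swap p₀ , P₀.reflect d)
      expanded-swap (inj₂ (eq , d)) = inj₂ (cong swap eq , R.reflect d)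

      grow-full : SymmetricFull μ grow
      grow-full = record
        { row-unique = λ d d′ → expanded-unique (dot-grow⁻ d) (dot-grow⁻ d′)
        ; row-dot    = λ c∈μ → let x , e = expanded-dot c∈μ in x , dot-grow⁺ e
        ; reflect    = λ d → dot-grow⁺ (expanded-swap (dot-grow⁻ d))
        }

      -- Inner dots are shaded, so outside the region only dots of `p₀` remain, and these determine
      -- the region.
      p₀~grow : p₀ ~ grow
      p₀~grow = shaded-invariant p₀ grow shaded? agree , agree
        where
        agree : AgreeOutside p₀ grow
        agree c ¬s = mk⇔ (λ d → dot-grow⁺ (inj₁ (¬s , d)))
          λ d → Sum.[ proj₂ , (λ i → contradiction (inner-shaded i) ¬s) ] (dot-grow⁻ d)

      shrink-grow : shrink grow ≡ r
      shrink-grow = Filling-ext ν (shrink grow) r λ c → mk⇔ (shrink⇒ c)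
        λ d → dot-shrink⁺ grow (∈ν⁻ (Dot⇒∈ₛ ν r d)) (dot-grow⁺ (inj₂ (inner-expand d)))
        where
        shrink⇒ : ∀ c → Dot ν (shrink grow) c → Dot ν r c
        shrink⇒ c d with s , d′ ← dot-shrink⁻ grow d with dot-grow⁻ d′
        ... | inj₁ (¬s , _) = contradiction s ¬s
        ... | inj₂ (_ , e)  = subst (Dot ν r) (compress-expand c) e

    module _ (γ : Permutation′ j) (γγ : Involutive _≡_ (γ ⟨$⟩ʳ_)) where

      -- With `R` taken from `Tα`, this unfolds to `replacePrefix α γ Tα`.
      WithPrefix : Pred Word ℓ
      WithPrefix σ = ∃ λ τ → R τ × σ ≡ oneLine γ ++ τ

      -- `shrink` is a bijection from the class onto the γ-avoiding placements on `ν`, with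
      -- preimages supplied by `grow`.
      class-count : ∀ {n} → HasCount (λ q → SymFullAvoiding μ WithPrefix q × p₀ ~ q) n →
                    SymCount ν ｛ oneLine γ ｝ n
      class-count = HasCount-map shrink
        (λ Q Q′ → shrink-injective (full Q , proj₂ Q) (full Q′ , proj₂ Q′))
        shrink-avoids grow-avoids
        where
        full : ∀ {q} → SymFullAvoiding μ WithPrefix q × p₀ ~ q → SymmetricFull μ q
        full ((pl , fl , q-sym , _) , _) = toSymmetricFull pl fl q-sym

        shrink-avoids : ∀ {q} → SymFullAvoiding μ WithPrefix q × p₀ ~ q →
                        SymFullAvoiding ν ｛ oneLine γ ｝ (shrink q)
        shrink-avoids {q} Q@((_ , _ , _ , avoids) , p₀~q) =
          toIsPlacement ν-conj shrink-full , toIsFull ν-conj shrink-full ,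
          toIsSymmetric ν-conj shrink-full ,
          λ { _ refl contains → let τ , Rτ , contains′ = shrink-contains⇒contains γ γγ contains in
                                avoids _ (τ , Rτ , refl) contains′ }
          where open InClass q (full Q) p₀~q

        grow-avoids : ∀ {r} → SymFullAvoiding ν ｛ oneLine γ ｝ r →
                      ∃ λ q → (SymFullAvoiding μ WithPrefix q × p₀ ~ q) × shrink q ≡ r
        grow-avoids {r} (pl , fl , r-sym , avoids) =
          grow ,
          ((toIsPlacement μ-conj grow-full , toIsFull μ-conj grow-full , toIsSymmetric μ-conj grow-full ,
            λ { _ (τ , Rτ , refl) contains → avoids _ refl
                  (subst (λ r → Contains ν r (oneLine γ)) shrink-grow
                    (InClass.contains⇒shrink-contains grow grow-full p₀~grow γ Rτ contains)) }) ,
           p₀~grow) ,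
          shrink-grow
          where open Expand r (toSymmetricFull pl fl r-sym)

-- Comparison of the counts class by class

theorem3p1 : ∀ {ℓ} (j : ℕ) → 1 ≤ j →
    (α β : Permutation′ j) →
    Involutive _≡_ (α ⟨$⟩ʳ_) →
    Involutive _≡_ (β ⟨$⟩ʳ_) →
    (Tα : Pred Word ℓ) → Tα ⊆ BeginsWith α →
    (∀ μ → SelfConjugate μ → ∀ a b →
    SymCount μ ｛ oneLine α ｝ a → SymCount μ ｛ oneLine β ｝ b → a ≡ b) →
    ∀ μ → SelfConjugate μ → ∀ a b →
    SymCount μ Tα a → SymCount μ (replacePrefix α β Tα) b → a ≡ b
theorem3p1 {ℓ} j 1≤j α β αα ββ Tα Tα⊆ hyp μ μ-conj _ _
  (xs , xs! , xs⇔ , refl) (ys , ys! , ys⇔ , refl) =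
  -- Equality of numbers is stable under double negation, so `_~_` may be assumed decidable on the
  -- finitely many fillings.
  decidable-stable (length xs ≟ length ys) λ ≢ →
    ¬¬-decidable (uncurry _~_)
      (λ (p , q) → ∈-cartesianProduct⁺ (∈-fillings p) (∈-fillings q)) λ ~? →
      ≢ (length-by-classes (λ p q → ~? (p , q)) ~-refl ~-joinʳ (length xs) xs ys ≤-refl
           (class-lengths λ p q → ~? (p , q)))
  where
  R : Pred Word ℓ
  R τ = Tα (oneLine α ++ τ)

  R> : ∀ {τ} → R τ → All (j <_) τ
  R> {τ} Tατ with r , τ′ , τ′↭ , eq ← Tα⊆ Tατ
    -- Left cancellation identifies `τ` with the tail given by `BeginsWith`, a rearrangement of j+1,
    -- ..., j+r.
    rewrite ++-cancelˡ (oneLine α) τ τ′ eq =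
    All-resp-↭ (↭-sym τ′↭) (All.applyUpTo⁺₂ _ r λ i → s≤s (m≤m+n j i))

  open Shading μ μ-conj j 1≤j R R>
  open Compression μ μ-conj j 1≤j R R>

  -- Every pattern in `Tα` begins with α, so replacing α by itself changes nothing; both counts then
  -- have the form that `class-count` expects.
  xs⇔′ : ∀ p → p ∈ₗ xs ⇔ SymFullAvoiding μ (replacePrefix α α Tα) p
  xs⇔′ p = mk⇔
    (λ (pl , fl , p-sym , avoids) → pl , fl , p-sym , λ { _ (τ , Tατ , refl) → avoids _ Tατ })
    (λ (pl , fl , p-sym , avoids) → pl , fl , p-sym , λ σ Tσ →
      let _ , τ , _ , σ≡ = Tα⊆ Tσ in avoids σ (τ , subst Tα σ≡ Tσ , σ≡))
    ⇔-∘ xs⇔ p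

  full : ∀ {p T} → SymFullAvoiding {ℓ} μ T p → SymmetricFull μ p
  full (pl , fl , p-sym , _) = toSymmetricFull pl fl p-sym

  -- The shape `ν` is built from the representative `p` without reference to a prefix, so both
  -- counts concern the same `ν` and `hyp` equates them.
  class-lengths : (~? : Binary.Decidable _~_) → ∀ p → p ∈ₗ xs ⊎ p ∈ₗ ys →
                  length (filter (~? p) xs) ≡ length (filter (~? p) ys)
  class-lengths ~? p p∈ = decidable-stable (_ ≟ _) λ ≢ → ¬¬-shaded? p λ shaded? →
    let active  = enumeration p p-full shaded?
        ν , ∈ν⇔ = compressedShape p p-full shaded? active
        open Class p p-full shaded? active ν ∈ν⇔
    in ≢ (hyp ν ν-conj _ _
           (class-count α αα (HasCount-filter (~? p) xs! xs⇔′))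
           (class-count β ββ (HasCount-filter (~? p) ys! ys⇔)))
    where
    p-full : SymmetricFull μ p
    p-full = Sum.[ full ∘ to (xs⇔ p) , full ∘ to (ys⇔ p) ] p∈
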